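{- For each integer $t\ge 1$ let $L_{\mathrm c}(t)$ be the number of $3\times 3$ magilatin squares all of whose entries are strictly between $0$ and $t$. Then $\sum_{t>0} L_{\mathrm c}(t)\,x^t$ equals $$\frac{12x^4\,B(x)}{(1-x^2)^2(1-x^3)^2(1-x^4)(1-x^5)},$$ where $$B(x)=79x^{15}+190x^{14}+260x^{13}+250x^{12}+211x^{11}+179x^{10}+181x^9+198x^8+210x^7+181x^6+125x^5+61x^4+22x^3+8x^2+4x+1.$$ Moreover, for every integer $t\ge1$, $$L_{\mathrm c}(t)=\begin{cases}\frac{3}{10}t^5-\frac{51}{8}t^4+\frac{202}{3}t^3-\frac{3769}{10}t^2+c_1(t)\,t-c_0(t), & t\text{ even},\\[3pt]\frac{3}{10}t^5-\frac{51}{8}t^4+\frac{202}{3}t^3-\frac{7493}{20}t^2+c_1(t)\,t-c_0(t), & t\text{ odd},\end{cases}$$ where $c_1(t)=994$ if $t\equiv0,2$; $986$ if $t\equiv4$; $\frac{1909}{2}$ if $t\equiv1$; $\frac{1925}{2}$ if $t\equiv3,5\pmod 6$; and $c_0(t)$ depends only on $t$ modulo $60$ and is given as follows, where in the line for $r$ the five numbers are the values of $c_0$ at $t\equiv r,\ r+12,\ r+24,\ r+36,\ r+48\pmod{60}$, in this order: $r=0$: $948,\ 948,\ \frac{4884}{5},\ \frac{4452}{5},\ \frac{4884}{5}$; $r=1$: $\frac{76933}{120},\ \frac{87301}{120},\ \frac{16769}{24},\ \frac{16769}{24},\ \frac{87301}{120}$; $r=2$: $\frac{2780}{3},\ \frac{14332}{15},\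 \frac{13036}{15},\ \frac{14332}{15},\ \frac{2780}{3}$; $r=3$: $\frac{35607}{40},\ \frac{6891}{8},\ \frac{6891}{8},\ \frac{35607}{40},\ \frac{32151}{40}$; $r=4$: $\frac{13292}{15},\ \frac{11996}{15},\ \frac{13292}{15},\ \frac{2572}{3},\ \frac{2572}{3}$; $r=5$: $\frac{18433}{24},\ \frac{18433}{24},\ \frac{95621}{120},\ \frac{85253}{120},\ \frac{95621}{120}$; $r=6$: $\frac{4452}{5},\ \frac{4884}{5},\ 948,\ 948,\ \frac{4884}{5}$; $r=7$: $\frac{18497}{24},\ \frac{95941}{120},\ \frac{85573}{120},\ \frac{95941}{120},\ \frac{18497}{24}$; $r=8$: $\frac{14332}{15},\ \frac{2780}{3},\ \frac{2780}{3},\ \frac{14332}{15},\ \frac{13036}{15}$; $r=9$: $\frac{32727}{40},\ \frac{29271}{40},\ \frac{32727}{40},\ \frac{6315}{8},\ \frac{6315}{8}$; $r=10$: $\frac{2572}{3},\ \frac{2572}{3},\ \frac{13292}{15},\ \frac{11996}{15},\ \frac{13292}{15}$; $r=11$: $\frac{93893}{120},\ \frac{104261}{120},\ \frac{20161}{24},\ \frac{20161}{24},\ \frac{104261}{120}$. The quasipolynomial $L_{\mathrm c}$ has period exactly $60$, and its principal constituent is $\frac{3}{10}t^5-\frac{51}{8}t^4+\frac{202}{3}t^3-\frac{3769}{10}t^2+994t-948$.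
   Context: A $3\times3$ magilatin square is a $3\times 3$ matrix of positive integers in which all three row sums and all three column sums are equal, and in which the three entries of each row are pairwise distinct and the three entries of each column are pairwise distinct (entries in different rows and different columns may be equal). Squares are counted as matrices (not up to symmetry). A function $N$ of $t\in\mathbb Z_{>0}$ is a quasipolynomial if there are a positive integer $p$ and polynomials $N_0,\dots,N_{p-1}$ (the constituents) with $N(t)=N_{t \bmod p}(t)$; the minimal such $p$ is the period, and $N_0$ is the principal constituent. -}

module Defs where

open import Data.Fin.Base using (Fin)
open import Data.Fin.Properties using (all?)
open import Data.Integer.Base as ℤ using (ℤ; +_; 0ℤ; 1ℤ)
open import Data.List.Base using (List; []; _∷_; cartesianProductWith; filter; foldr; length; upTo)
open import Data.List.Membership.Propositional using (_∈_)
open import Data.List.Membership.Propositional.Properties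
  using (∈-cartesianProductWith⁺; ∈-filter⁺; ∈-filter⁻; ∈-upTo⁺)
open import Data.List.Relation.Unary.Any using (here)
import Data.List.Relation.Unary.AllPairs as ListAllPairs
import Data.List.Relation.Unary.All as ListAll
open import Data.List.Relation.Unary.Unique.Propositional using () renaming (Unique to UniqueList)
import Data.List.Relation.Unary.Unique.Propositional.Properties as UniqueList
open import Data.Nat.Base using (ℕ; zero; suc; _∸_; _<_; _≤_; NonZero)
open import Data.Nat.DivMod using (_mod_; _/_)
import Data.Nat.Properties as ℕ
open import Data.Product.Base using (∃-syntax; _×_; _,_; proj₂)
open import Data.Rational.Base as ℚ using (ℚ; 0ℚ)
open import Data.Vec.Base using (Vec; []; _∷_; lookup; map; sum; transpose; _++_)
open import Data.Vec.Properties using (∷-injective)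
open import Data.Vec.Relation.Unary.All as All using (All; []; _∷_)
import Data.Vec.Relation.Unary.AllPairs as AllPairs
open import Data.Vec.Relation.Unary.Unique.Propositional using (Unique)
open import Function.Bundles using (_⇔_; mk⇔)
open import Level using (Level)
open import Relation.Binary.PropositionalEquality using (_≡_)
open import Relation.Nullary.Decidable using (Dec; map′; ¬?; _×-dec_)

private
  variable
    a p : Level
    A : Set a
    n : ℕ

Matrix : Set
Matrix = Vec (Vec ℕ 3) 3

AllEntries : (ℕ → Set) → Matrix → Set
AllEntries P = All (All P)

lineSums : Matrix → Vec ℕ 6
lineSums M = map sum M ++ map sum (transpose M)

AllEqual : Vec ℕ n → Set
AllEqual v = ∀ i j → lookup v i ≡ lookup v j

record IsMagilatin (M : Matrix) : Set where
  constructor magilatin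
  field
    positive        : AllEntries (0 <_) M
    sumsEqual       : AllEqual (lineSums M)
    rowsDistinct    : All Unique M
    columnsDistinct : All Unique (transpose M)

StrictlyBetween : ℕ → ℕ → Matrix → Set
StrictlyBetween l u = AllEntries (λ x → l < x × x < u)

CubicalMagilatin : ℕ → Matrix → Set
CubicalMagilatin t M = IsMagilatin M × StrictlyBetween 0 t M

-- A predicate with finitely many witnesses, all of them listed exactly once.
record Enumeration {A : Set a} (P : A → Set p) : Set (a Level.⊔ p) where
  field
    list     : List A
    unique   : UniqueList list
    complete : ∀ x → x ∈ list ⇔ P x

  cardinality : ℕ
  cardinality = length list

open Enumeration public using (cardinality)

private
  unique? : (v : Vec ℕ n) → Dec (Unique v)
  unique? = AllPairs.allPairs? (λ x y → ¬? (x ℕ.≟ y))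

  allEqual? : (v : Vec ℕ n) → Dec (AllEqual v)
  allEqual? v = all? (λ i → all? (λ j → lookup v i ℕ.≟ lookup v j))

  isMagilatin? : (M : Matrix) → Dec (IsMagilatin M)
  isMagilatin? M = map′
    (λ (pos , eq , rows , cols) → magilatin pos eq rows cols)
    (λ (magilatin pos eq rows cols) → pos , eq , rows , cols)
    (All.all? (All.all? (0 ℕ.<?_)) M
      ×-dec allEqual? (lineSums M)
      ×-dec All.all? unique? M
      ×-dec All.all? unique? (transpose M))

cubicalMagilatin? : ∀ t (M : Matrix) → Dec (CubicalMagilatin t M)
cubicalMagilatin? t M =
  isMagilatin? M
    ×-dec All.all? (All.all? (λ x → (0 ℕ.<? x) ×-dec (x ℕ.<? t))) M

vectorsOver : List A → ∀ n → List (Vec A n)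
vectorsOver xs zero    = [] ∷ []
vectorsOver xs (suc n) = cartesianProductWith _∷_ xs (vectorsOver xs n)

vectorsOver-unique : {xs : List A} → UniqueList xs → ∀ n → UniqueList (vectorsOver xs n)
vectorsOver-unique u zero    = ListAll.[] ListAllPairs.∷ ListAllPairs.[]
vectorsOver-unique u (suc n) =
  UniqueList.cartesianProductWith⁺ _∷_ ∷-injective u (vectorsOver-unique u n)

∈-vectorsOver : {xs : List A} {v : Vec A n} → All (_∈ xs) v → v ∈ vectorsOver xs n
∈-vectorsOver []       = here _≡_.refl
∈-vectorsOver (x ∷ xs) = ∈-cartesianProductWith⁺ _∷_ x (∈-vectorsOver xs)

matricesBelow : ℕ → List Matrix
matricesBelow t = vectorsOver (vectorsOver (upTo t) 3) 3

cubicalMagilatins : ∀ t → Enumeration (CubicalMagilatin t)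
cubicalMagilatins t = record
  { list     = filter (cubicalMagilatin? t) (matricesBelow t)
  ; unique   = UniqueList.filter⁺ (cubicalMagilatin? t)
                 (vectorsOver-unique (vectorsOver-unique (UniqueList.upTo⁺ t) 3) 3)
  ; complete = λ M → mk⇔
      (λ M∈ → proj₂ (∈-filter⁻ (cubicalMagilatin? t) {xs = matricesBelow t} M∈))
      (λ PM → ∈-filter⁺ (cubicalMagilatin? t)
        (∈-vectorsOver (All.map (λ r → ∈-vectorsOver (All.map (λ b → ∈-upTo⁺ (proj₂ b)) r))
                                (proj₂ PM)))
        PM)
  }

Lᶜ : ℕ → ℕ
Lᶜ t = cardinality (cubicalMagilatins t)

-- The series ∑ (s n) xⁿ.
Series : Set
Series = ℕ → ℤ

infix  4 _≈_ _≈_÷_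
infixl 6 _⊕_ _⊖_
infixl 7 _⊛_
infixr 8 _·_
infixr 9 _^_
infix  10 X^_

_≈_ : Series → Series → Set
f ≈ g = ∀ n → f n ≡ g n

_⊕_ _⊖_ _⊛_ : Series → Series → Series
(f ⊕ g) n = f n ℤ.+ g n
(f ⊖ g) n = f n ℤ.- g n
(f ⊛ g) n = ∑≤ n (λ i → f i ℤ.* g (n ∸ i))
  where
  ∑≤ : ℕ → (ℕ → ℤ) → ℤ
  ∑≤ zero    h = h zero
  ∑≤ (suc m) h = ∑≤ m h ℤ.+ h (suc m)

X^_ : ℕ → Series
(X^ zero)  zero    = 1ℤ
(X^ zero)  (suc n) = 0ℤ
(X^ suc k) zero    = 0ℤ
(X^ suc k) (suc n) = (X^ k) n

𝟙 : Series
𝟙 = X^ 0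

_·_ : ℕ → Series → Series
(a · f) n = + a ℤ.* f n

_^_ : Series → ℕ → Series
f ^ zero  = 𝟙
f ^ suc k = f ⊛ f ^ k

-- f equals the fraction g / h, that is, h is invertible and f = g h⁻¹.
_≈_÷_ : Series → Series → Series → Set
f ≈ g ÷ h = ∃[ h⁻¹ ] (h ⊛ h⁻¹ ≈ 𝟙) × (f ≈ g ⊛ h⁻¹)

-- ∑_{t > 0} N(t) xᵗ
generatingFunction : (ℕ → ℕ) → Series
generatingFunction N zero    = 0ℤ
generatingFunction N (suc n) = + N (suc n)

B : Series
B = 79 · X^ 15 ⊕ 190 · X^ 14 ⊕ 260 · X^ 13 ⊕ 250 · X^ 12
  ⊕ 211 · X^ 11 ⊕ 179 · X^ 10 ⊕ 181 · X^ 9 ⊕ 198 · X^ 8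
  ⊕ 210 · X^ 7 ⊕ 181 · X^ 6 ⊕ 125 · X^ 5 ⊕ 61 · X^ 4
  ⊕ 22 · X^ 3 ⊕ 8 · X^ 2 ⊕ 4 · X^ 1 ⊕ 𝟙

fromℕ : ℕ → ℚ
fromℕ n = + n ℚ./ 1

-- Coefficients, constant term first.
Polynomial : Set
Polynomial = List ℚ

eval : Polynomial → ℚ → ℚ
eval f x = foldr (λ a r → a ℚ.+ x ℚ.* r) 0ℚ f

-- N is regarded as a function on the positive integers: N 0 is ignored.
record Quasipolynomial (N : ℕ → ℚ) (p : ℕ) .{{_ : NonZero p}} : Set where
  field
    constituent : Fin p → Polynomial
    represents  : ∀ t → 1 ≤ t → N t ≡ eval (constituent (t mod p)) (fromℕ t)

  principal : Polynomial
  principal = constituent (0 mod p)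

open Quasipolynomial public using (principal)

IsMinimalModulus : (N : ℕ → ℚ) (p : ℕ) → Set
IsMinimalModulus N p = ∀ q .{{_ : NonZero q}} → Quasipolynomial N q → p ≤ q

c₁ : ℕ → ℚ
c₁ t = lookup values (t mod 6)
  where
  values : Vec ℚ 6
  values = + 994 ℚ./ 1 ∷ + 1909 ℚ./ 2 ∷ + 994 ℚ./ 1
         ∷ + 1925 ℚ./ 2 ∷ + 986 ℚ./ 1 ∷ + 1925 ℚ./ 2 ∷ []

-- Row r lists the values at t ≡ r, r + 12, r + 24, r + 36, r + 48 (mod 60).
c₀-table : Vec (Vec ℚ 5) 12
c₀-table =
    (+ 948 ℚ./ 1 ∷ + 948 ℚ./ 1 ∷ + 4884 ℚ./ 5 ∷ + 4452 ℚ./ 5 ∷ + 4884 ℚ./ 5 ∷ [])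
  ∷ (+ 76933 ℚ./ 120 ∷ + 87301 ℚ./ 120 ∷ + 16769 ℚ./ 24 ∷ + 16769 ℚ./ 24 ∷ + 87301 ℚ./ 120 ∷ [])
  ∷ (+ 2780 ℚ./ 3 ∷ + 14332 ℚ./ 15 ∷ + 13036 ℚ./ 15 ∷ + 14332 ℚ./ 15 ∷ + 2780 ℚ./ 3 ∷ [])
  ∷ (+ 35607 ℚ./ 40 ∷ + 6891 ℚ./ 8 ∷ + 6891 ℚ./ 8 ∷ + 35607 ℚ./ 40 ∷ + 32151 ℚ./ 40 ∷ [])
  ∷ (+ 13292 ℚ./ 15 ∷ + 11996 ℚ./ 15 ∷ + 13292 ℚ./ 15 ∷ + 2572 ℚ./ 3 ∷ + 2572 ℚ./ 3 ∷ [])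
  ∷ (+ 18433 ℚ./ 24 ∷ + 18433 ℚ./ 24 ∷ + 95621 ℚ./ 120 ∷ + 85253 ℚ./ 120 ∷ + 95621 ℚ./ 120 ∷ [])
  ∷ (+ 4452 ℚ./ 5 ∷ + 4884 ℚ./ 5 ∷ + 948 ℚ./ 1 ∷ + 948 ℚ./ 1 ∷ + 4884 ℚ./ 5 ∷ [])
  ∷ (+ 18497 ℚ./ 24 ∷ + 95941 ℚ./ 120 ∷ + 85573 ℚ./ 120 ∷ + 95941 ℚ./ 120 ∷ + 18497 ℚ./ 24 ∷ [])
  ∷ (+ 14332 ℚ./ 15 ∷ + 2780 ℚ./ 3 ∷ + 2780 ℚ./ 3 ∷ + 14332 ℚ./ 15 ∷ + 13036 ℚ./ 15 ∷ [])
  ∷ (+ 32727 ℚ./ 40 ∷ + 29271 ℚ./ 40 ∷ + 32727 ℚ./ 40 ∷ + 6315 ℚ./ 8 ∷ + 6315 ℚ./ 8 ∷ [])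
  ∷ (+ 2572 ℚ./ 3 ∷ + 2572 ℚ./ 3 ∷ + 13292 ℚ./ 15 ∷ + 11996 ℚ./ 15 ∷ + 13292 ℚ./ 15 ∷ [])
  ∷ (+ 93893 ℚ./ 120 ∷ + 104261 ℚ./ 120 ∷ + 20161 ℚ./ 24 ∷ + 20161 ℚ./ 24 ∷ + 104261 ℚ./ 120 ∷ [])
  ∷ []

-- For t ≡ r + 12 k (mod 60) with r < 12 and k < 5, r = t mod 12 and
-- k = ⌊t / 12⌋ mod 5.
c₀ : ℕ → ℚ
c₀ t = lookup (lookup c₀-table (t mod 12)) ((t / 12) mod 5)

{-# OPTIONS --safe #-}

-- The nine entries of a magilatin square and the bound t form a positive integer
-- solution of a system of linear equations, inequalities and disequations in ten
-- unknowns. Elliott's method decomposes the solutions: starting from the cone of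
-- all positive combinations of the unit vectors, a cone on which a constraint
-- changes sign is split by comparing the multiplicities of two generators g and h
-- that lie on opposite sides (g + h replaces both, or one of them), until each
-- constraint has constant sign on each cone. Distinct multiplicities always give
-- distinct solutions, so a cone whose generators have t-coordinates w₁, …, wₖ
-- contributes ∏ x^wᵢ / (1 - x^wᵢ) to the generating function, and the sum of these
-- fractions is the stated one. All its poles are 60th roots of unity of order at
-- most 6, and the sixth difference with step 60 of the stated quasipolynomial
-- vanishes too; hence both are determined by finitely many values, where they
-- agree. Finally, a quasipolynomial of modulus q has, at every t, the same
-- constituent as L (they agree at infinitely many integers), so q is a period of
-- the constant term c₀, which has no period below 60.
module Submission where

open import Defs
open import Algebra.Bundles using (CommutativeRing; CommutativeSemiring)
import Algebra.Properties.CommutativeSemigroup as CommutativeSemigroupProperties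
import Algebra.Properties.Ring as RingProperties
import Algebra.Solver.CommutativeMonoid as CommutativeMonoidSolver
import Algebra.Solver.Ring.NaturalCoefficients.Default as NaturalCoefficients
open import Algebra.Structures using (IsCommutativeRing)
open import Data.Empty using (⊥-elim)
open import Data.Fin using (#_)
open import Data.Fin.Base using (Fin; zero; suc; toℕ; fromℕ<)
import Data.Fin.Properties as Fin
open import Data.Integer.Base as ℤ using (ℤ; +_; 0ℤ; 1ℤ)
import Data.Integer.Properties as ℤ
import Data.Integer.Solver as ℤSolver
open import Data.Integer.Tactic.RingSolver using (solve-∀)
open import Data.List.Base as List using (List; []; _∷_; [_]; _++_; applyUpTo; foldr; length)
open import Data.List.Membership.Propositional using (_∈_)
open import Data.List.Membership.Propositional.Properties
  using (∈-map⁺; ∈-map⁻; ∈-++⁺ˡ; ∈-++⁺ʳ; ∈-++⁻)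
open import Data.List.Membership.Propositional.Properties.WithK using (unique∧set⇒bag)
import Data.List.Properties as List
open import Data.List.Relation.Binary.BagAndSetEquality using (∼bag⇒↭)
open import Data.List.Relation.Binary.Permutation.Propositional.Properties using (↭-length)
open import Data.List.Relation.Unary.All as All using (All; []; _∷_)
import Data.List.Relation.Unary.AllPairs as AllPairs
import Data.List.Relation.Unary.Any as ListAny
import Data.List.Relation.Unary.Unique.Propositional.Properties as Unique
open import Data.Maybe.Base as Maybe using (Maybe; just; nothing)
import Data.Maybe.Properties as Maybe
open import Data.Nat.Base as ℕ
  using (ℕ; zero; suc; _∸_; _≤_; z≤n; s≤s; z<s; NonZero; compare; less; equal; greater; _%_)
open import Data.Nat.Divisibility using (_∣_; _∤_; divides; n∣m⇒m%n≡0; m%n≡0⇒n∣m)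
open import Data.Nat.DivMod using (_mod_; m<n⇒m%n≡m; m%n<n; m≡m%n+[m/n]*n; [m+n]%n≡m%n
  ; [m+kn]%n≡m%n; +-distrib-/-∣ˡ)
open import Data.Nat.Induction using (<-rec)
import Data.Nat.Properties as ℕ
open import Data.Nat.Tactic.RingSolver using () renaming (solve-∀ to solve-∀-ℕ)
open import Data.Product.Base using (Σ; Σ-syntax; ∃-syntax; _×_; _,_; proj₁; map₂)
open import Data.Rational.Base as ℚ using (ℚ; 0ℚ; 1ℚ)
import Data.Rational.Properties as ℚ
open import Data.Rational.Unnormalised.Base as ℚᵘ using (mkℚᵘ; *≡*)
import Data.Rational.Unnormalised.Properties as ℚᵘ
open import Data.Sum.Base using (_⊎_; inj₁; inj₂; [_,_]′)
open import Data.Sum.Properties using (inj₁-injective; inj₂-injective)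
open import Data.Unit.Base using (⊤; tt)
open import Data.Vec.Base as Vec
  using (Vec; []; _∷_; insertAt; lookup; removeAt; replicate; toList; zipWith)
open import Data.Vec.Properties
  using (insertAt-lookup; insertAt-removeAt; lookup-map; lookup-replicate; lookup-zipWith; removeAt-insertAt)
open import Data.Vec.Relation.Unary.All using ([]; _∷_)
open import Data.Vec.Relation.Unary.AllPairs using ([]; _∷_)
open import Data.Vec.Relation.Unary.Any using (Any; any?; here; index; there)
open import Data.Vec.Relation.Unary.Any.Properties using (lookup-index)
open import Function.Base using (_∘_; id)
open import Function.Bundles using (mk⇔; module Equivalence)
open import Function.Definitions using (Injective)
open import Function.Properties.Equivalence using () renaming (sym to ⇔-sym; trans to ⇔-trans)
open import Level using (0ℓ)
import Relation.Binary.Reasoning.Setoid as SetoidReasoning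
open import Relation.Binary.PropositionalEquality
  using (_≡_; _≢_; refl; sym; trans; cong; cong₂; subst; subst₂; module ≡-Reasoning)
open import Relation.Nullary using (¬_; Dec; yes; no)
open import Relation.Nullary.Decidable using (toWitness; ¬?)

-- Formal power series

tail : Series → Series
tail f = f ∘ suc

-- The local sum in the definition of _⊛_ cannot be named, so it is recovered
-- by unification: abstracting suc n separates the bound of the sum from the
-- index it is used at, and abstracting _+_ makes the equation solvable.
mutual
  partialSum : Series → Series → ℕ → ℕ → ℤ
  partialSum = _

  ⊛-partialSum : ∀ f g n → (f ⊛ g) (suc n) ≡ partialSum f g (suc n) n ℤ.+ f (suc n) ℤ.* g (n ∸ n)
  ⊛-partialSum f g n with suc n | ℤ._+_
  ... | _ | _ = refl

-- For `i` up to `m`, `suc m ∸ i` equals `suc (m ∸ i)`; past `m` truncation breaks this, hence the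
-- hypothesis.
partialSum-last : ∀ f g {m n} → n ℕ.≤ m → partialSum f g (suc m) n ≡ partialSum f (tail g) m n
partialSum-last f g {n = zero}  _   = refl
partialSum-last f g {n = suc n} n≤m = cong₂ ℤ._+_ (partialSum-last f g (ℕ.<⇒≤ n≤m))
  (cong (λ k → f (suc n) ℤ.* g k) (ℕ.+-∸-assoc 1 n≤m))

partialSum-head : ∀ f g m n →
  partialSum f g (suc m) (suc n) ≡ f 0 ℤ.* g (suc m) ℤ.+ partialSum (tail f) g m n
partialSum-head f g m zero    = refl
partialSum-head f g m (suc n) = trans
  (cong (ℤ._+ f (suc (suc n)) ℤ.* g (m ∸ suc n)) (partialSum-head f g m n))
  (ℤ.+-assoc (f 0 ℤ.* g (suc m)) _ _)

⊛-last : ∀ f g n → (f ⊛ g) (suc n) ≡ (f ⊛ tail g) n ℤ.+ f (suc n) ℤ.* g 0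
⊛-last f g n = cong₂ (λ a k → a ℤ.+ f (suc n) ℤ.* g k) (partialSum-last f g (ℕ.≤-refl {n})) (ℕ.n∸n≡0 n)

-- Turns the convolution into a recursion on the degree, with `tail f` as first factor. The ring
-- laws below are inductions along it, over all series at once.
⊛-head : ∀ f g n → (f ⊛ g) (suc n) ≡ f 0 ℤ.* g (suc n) ℤ.+ (tail f ⊛ g) n
⊛-head f g n = partialSum-head f g n n

-- Removing the first summand of `f ⊛ g` and the last summand of `g ⊛ f` leaves two convolutions one
-- degree lower, which agree by induction.
⊛-comm : ∀ f g → f ⊛ g ≈ g ⊛ f
⊛-comm f g zero    = ℤ.*-comm (f 0) (g 0)
⊛-comm f g (suc n) = begin
  (f ⊛ g) (suc n)                             ≡⟨ ⊛-head f g n ⟩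
  f 0 ℤ.* g (suc n) ℤ.+ (tail f ⊛ g) n        ≡⟨ ℤ.+-comm (f 0 ℤ.* g (suc n)) _ ⟩
  (tail f ⊛ g) n ℤ.+ f 0 ℤ.* g (suc n)        ≡⟨ cong₂ ℤ._+_ (⊛-comm (tail f) g n) (ℤ.*-comm (f 0) (g (suc n))) ⟩
  (g ⊛ tail f) n ℤ.+ g (suc n) ℤ.* f 0        ≡⟨ ⊛-last g f n ⟨
  (g ⊛ f) (suc n)                             ∎
  where open ≡-Reasoning

⊛-cong : ∀ {f f′ g g′} → f ≈ f′ → g ≈ g′ → f ⊛ g ≈ f′ ⊛ g′
⊛-cong p q zero    = cong₂ ℤ._*_ (p 0) (q 0)
⊛-cong {f} {f′} {g} {g′} p q (suc n) = begin
  (f ⊛ g) (suc n)                             ≡⟨ ⊛-head f g n ⟩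
  f 0 ℤ.* g (suc n) ℤ.+ (tail f ⊛ g) n        ≡⟨ cong₂ ℤ._+_ (cong₂ ℤ._*_ (p 0) (q (suc n))) (⊛-cong (p ∘ suc) q n) ⟩
  f′ 0 ℤ.* g′ (suc n) ℤ.+ (tail f′ ⊛ g′) n    ≡⟨ ⊛-head f′ g′ n ⟨
  (f′ ⊛ g′) (suc n)                           ∎
  where open ≡-Reasoning

⊛-distribʳ-⊕ : ∀ h f g → (f ⊕ g) ⊛ h ≈ f ⊛ h ⊕ g ⊛ h
⊛-distribʳ-⊕ h f g zero    = ℤ.*-distribʳ-+ (h 0) (f 0) (g 0)
⊛-distribʳ-⊕ h f g (suc n)
  rewrite ⊛-head (f ⊕ g) h n | ⊛-distribʳ-⊕ h (tail f) (tail g) n | ⊛-head f h n | ⊛-head g h n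
  = regroup (f 0) (g 0) (h (suc n)) ((tail f ⊛ h) n) ((tail g ⊛ h) n)
  where
  regroup : ∀ a b c d e → (a ℤ.+ b) ℤ.* c ℤ.+ (d ℤ.+ e) ≡ a ℤ.* c ℤ.+ d ℤ.+ (b ℤ.* c ℤ.+ e)
  regroup = solve-∀

⊛-scale : ∀ a f g → (λ n → a ℤ.* f n) ⊛ g ≈ (λ n → a ℤ.* (f ⊛ g) n)
⊛-scale a f g zero    = ℤ.*-assoc a (f 0) (g 0)
⊛-scale a f g (suc n)
  rewrite ⊛-head (λ n → a ℤ.* f n) g n | ⊛-scale a (tail f) g n | ⊛-head f g n
  = regroup a (f 0) (g (suc n)) ((tail f ⊛ g) n)
  where
  regroup : ∀ a b c d → a ℤ.* b ℤ.* c ℤ.+ a ℤ.* d ≡ a ℤ.* (b ℤ.* c ℤ.+ d)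
  regroup = solve-∀

⊛-assoc : ∀ f g h → (f ⊛ g) ⊛ h ≈ f ⊛ (g ⊛ h)
⊛-assoc f g h zero    = ℤ.*-assoc (f 0) (g 0) (h 0)
⊛-assoc f g h (suc n) = begin
  ((f ⊛ g) ⊛ h) (suc n)
    ≡⟨ ⊛-head (f ⊛ g) h n ⟩
  f 0 ℤ.* g 0 ℤ.* h (suc n) ℤ.+ (tail (f ⊛ g) ⊛ h) n
    ≡⟨ cong (ℤ._+_ (f 0 ℤ.* g 0 ℤ.* h (suc n))) (⊛-cong {g = h} (⊛-head f g) (λ _ → refl) n) ⟩
  f 0 ℤ.* g 0 ℤ.* h (suc n) ℤ.+ (((λ m → f 0 ℤ.* tail g m) ⊕ tail f ⊛ g) ⊛ h) n
    ≡⟨ cong (ℤ._+_ (f 0 ℤ.* g 0 ℤ.* h (suc n))) (⊛-distribʳ-⊕ h (λ m → f 0 ℤ.* tail g m) (tail f ⊛ g) n) ⟩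
  f 0 ℤ.* g 0 ℤ.* h (suc n) ℤ.+ (((λ m → f 0 ℤ.* tail g m) ⊛ h) n ℤ.+ ((tail f ⊛ g) ⊛ h) n)
    ≡⟨ cong₂ (λ a b → f 0 ℤ.* g 0 ℤ.* h (suc n) ℤ.+ (a ℤ.+ b)) (⊛-scale (f 0) (tail g) h n) (⊛-assoc (tail f) g h n) ⟩
  f 0 ℤ.* g 0 ℤ.* h (suc n) ℤ.+ (f 0 ℤ.* (tail g ⊛ h) n ℤ.+ (tail f ⊛ (g ⊛ h)) n)
    ≡⟨ regroup (f 0) (g 0) (h (suc n)) _ _ ⟩
  f 0 ℤ.* (g 0 ℤ.* h (suc n) ℤ.+ (tail g ⊛ h) n) ℤ.+ (tail f ⊛ (g ⊛ h)) n
    ≡⟨ cong (λ a → f 0 ℤ.* a ℤ.+ (tail f ⊛ (g ⊛ h)) n) (⊛-head g h n) ⟨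
  f 0 ℤ.* (g ⊛ h) (suc n) ℤ.+ (tail f ⊛ (g ⊛ h)) n
    ≡⟨ ⊛-head f (g ⊛ h) n ⟨
  (f ⊛ (g ⊛ h)) (suc n) ∎
  where
  open ≡-Reasoning
  regroup : ∀ a b c d e → a ℤ.* b ℤ.* c ℤ.+ (a ℤ.* d ℤ.+ e) ≡ a ℤ.* (b ℤ.* c ℤ.+ d) ℤ.+ e
  regroup = solve-∀

⊛-zeroˡ : ∀ f → (λ _ → 0ℤ) ⊛ f ≈ (λ _ → 0ℤ)
⊛-zeroˡ f zero    = refl
⊛-zeroˡ f (suc n) rewrite ⊛-head (λ _ → 0ℤ) f n | ⊛-zeroˡ f n = refl

⊛-identityˡ : ∀ f → 𝟙 ⊛ f ≈ f
⊛-identityˡ f zero    = ℤ.*-identityˡ (f 0)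
⊛-identityˡ f (suc n) rewrite ⊛-head 𝟙 f n | ⊛-zeroˡ f n =
  trans (ℤ.+-identityʳ _) (ℤ.*-identityˡ (f (suc n)))

seriesIsCommutativeRing : IsCommutativeRing _≈_ _⊕_ _⊛_ (λ f n → ℤ.- f n) (λ _ → 0ℤ) 𝟙
seriesIsCommutativeRing = record
  { isRing = record
    { +-isAbelianGroup = record
      { isGroup = record
        { isMonoid = record
          { isSemigroup = record
            { isMagma = record
              { isEquivalence = record
                { refl  = λ _ → refl
                ; sym   = λ p n → sym (p n)
                ; trans = λ p q n → trans (p n) (q n)
                }
              ; ∙-cong = λ p q n → cong₂ ℤ._+_ (p n) (q n)
              }
            ; assoc = λ f g h n → ℤ.+-assoc (f n) (g n) (h n)
            }
          ; identity = (λ f n → ℤ.+-identityˡ (f n)) , (λ f n → ℤ.+-identityʳ (f n))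
          }
        ; inverse = (λ f n → ℤ.+-inverseˡ (f n)) , (λ f n → ℤ.+-inverseʳ (f n))
        ; ⁻¹-cong = λ p n → cong ℤ.-_ (p n)
        }
      ; comm = λ f g n → ℤ.+-comm (f n) (g n)
      }
    ; *-cong = ⊛-cong
    ; *-assoc = ⊛-assoc
    ; *-identity = ⊛-identityˡ , λ f n → trans (⊛-comm f 𝟙 n) (⊛-identityˡ f n)
    ; distrib =
        (λ h f g n → trans (⊛-comm h (f ⊕ g) n)
          (trans (⊛-distribʳ-⊕ h f g n) (cong₂ ℤ._+_ (⊛-comm f h n) (⊛-comm g h n))))
      , ⊛-distribʳ-⊕
    }
  ; *-comm = ⊛-comm
  }

seriesRing : CommutativeRing 0ℓ 0ℓ
seriesRing = record { isCommutativeRing = seriesIsCommutativeRing }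

open CommutativeRing seriesRing using (setoid) renaming
  ( refl to ≈-refl; sym to ≈-sym; trans to ≈-trans; +-cong to ⊕-cong; *-identityʳ to ⊛-identityʳ
  ; distribˡ to ⊛-distribˡ-⊕; *-commutativeMonoid to ⊛-commutativeMonoid
  ; *-commutativeSemigroup to ⊛-commutativeSemigroup; ring to seriesRing′)
open RingProperties seriesRing′ using () renaming (-‿distribˡ-* to negate-⊛ˡ)
open CommutativeSemigroupProperties ⊛-commutativeSemigroup using () renaming
  (x∙yz≈y∙xz to ⊛-swap; interchange to ⊛-interchange)

module ≈-Reasoning = SetoidReasoning setoid

⊛-congˡ : ∀ h {f g} → f ≈ g → h ⊛ f ≈ h ⊛ g
⊛-congˡ h = ⊛-cong (≈-refl {h})

⊛-congʳ : ∀ h {f g} → f ≈ g → f ⊛ h ≈ g ⊛ h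
⊛-congʳ h f≈g = ⊛-cong f≈g (≈-refl {h})

X⊛-tail : ∀ k f → tail (X^ suc k ⊛ f) ≈ X^ k ⊛ f
X⊛-tail k f n = trans (⊛-head (X^ suc k) f n) (ℤ.+-identityˡ _)

X⊛-below : ∀ k f {n} → n ℕ.< k → (X^ k ⊛ f) n ≡ 0ℤ
X⊛-below (suc k) f {zero}  _         = refl
X⊛-below (suc k) f {suc n} (s≤s n<k) = trans (X⊛-tail k f n) (X⊛-below k f n<k)

X⊛-above : ∀ k f n → (X^ k ⊛ f) (k ℕ.+ n) ≡ f n
X⊛-above zero    f n = ⊛-identityˡ f n
X⊛-above (suc k) f n = trans (X⊛-tail k f (k ℕ.+ n)) (X⊛-above k f n)

-- A view of a degree relative to `k`: it separates the coefficients that `X^ k` makes zero from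
-- those that it shifts.
data Position (k : ℕ) : ℕ → Set where
  below : ∀ {n} → n ℕ.< k → Position k n
  above : ∀ n → Position k (k ℕ.+ n)

position : ∀ k n → Position k n
position k n with ℕ.<-≤-connex n k
... | inj₁ n<k = below n<k
... | inj₂ k≤n = subst (Position k) (ℕ.m+[n∸m]≡n k≤n) (above (n ∸ k))

𝟙⊖X-⊛ : ∀ k f → (𝟙 ⊖ X^ k) ⊛ f ≈ f ⊖ X^ k ⊛ f
𝟙⊖X-⊛ k f = begin
  -- Integer subtraction unfolds to adding the negative, so `⊖` is `⊕` with a negated series and
  -- distributivity applies.
  (𝟙 ⊖ X^ k) ⊛ f                        ≈⟨ ⊛-distribʳ-⊕ f 𝟙 (λ n → ℤ.- (X^ k) n) ⟩
  𝟙 ⊛ f ⊕ (λ n → ℤ.- (X^ k) n) ⊛ f      ≈⟨ ⊕-cong (⊛-identityˡ f) (≈-sym (negate-⊛ˡ (X^ k) f)) ⟩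
  f ⊖ X^ k ⊛ f                          ∎
  where open ≈-Reasoning

𝟙⊖X-below : ∀ k f {n} → n ℕ.< k → ((𝟙 ⊖ X^ k) ⊛ f) n ≡ f n
𝟙⊖X-below k f {n} n<k = trans (𝟙⊖X-⊛ k f n)
  (trans (cong (ℤ._-_ (f n)) (X⊛-below k f n<k)) (ℤ.+-identityʳ (f n)))

𝟙⊖X-above : ∀ k f n → ((𝟙 ⊖ X^ k) ⊛ f) (k ℕ.+ n) ≡ f (k ℕ.+ n) ℤ.- f n
𝟙⊖X-above k f n = trans (𝟙⊖X-⊛ k f (k ℕ.+ n)) (cong (ℤ._-_ (f (k ℕ.+ n))) (X⊛-above k f n))

-- The indicator of the multiples of k.
geometric : (k : ℕ) .{{_ : NonZero k}} → Series
geometric k n = (X^ (n % k)) 0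

-- Below `k` the only multiple of `k` is 0; from `k` on, the coefficients at `n` and `n - k` cancel,
-- having the same remainder.
𝟙⊖X-geometric : ∀ k .{{_ : NonZero k}} → (𝟙 ⊖ X^ k) ⊛ geometric k ≈ 𝟙
𝟙⊖X-geometric k n with position k n
... | below n<k = trans (𝟙⊖X-below k (geometric k) n<k)
                    (trans (cong (λ m → (X^ m) 0) (m<n⇒m%n≡m n<k)) (indicator n))
  where
  indicator : ∀ n → (X^ n) 0 ≡ 𝟙 n
  indicator zero    = refl
  indicator (suc n) = refl
𝟙⊖X-geometric k@(suc _) n | above m = trans (𝟙⊖X-above k (geometric k) m)
  (trans (cong (λ j → (X^ j) 0 ℤ.- geometric k m)
           (trans (cong (_% k) (ℕ.+-comm k m)) ([m+n]%n≡m%n m k)))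
         (ℤ.+-inverseʳ (geometric k m)))

∏𝟙⊖X : List ℕ → Series
∏𝟙⊖X = foldr (λ k f → (𝟙 ⊖ X^ k) ⊛ f) 𝟙

Invertible : Series → Set
Invertible f = ∃[ f⁻¹ ] f ⊛ f⁻¹ ≈ 𝟙

∏𝟙⊖X-invertible : ∀ {ks} → All NonZero ks → Invertible (∏𝟙⊖X ks)
∏𝟙⊖X-invertible []                           = 𝟙 , ⊛-identityˡ 𝟙
∏𝟙⊖X-invertible {k ∷ ks} (k≢0 ∷ nz) =
  let instance _ = k≢0
      (f⁻¹ , inv) = ∏𝟙⊖X-invertible nz
  in geometric k ⊛ f⁻¹ , (begin
    ((𝟙 ⊖ X^ k) ⊛ ∏𝟙⊖X ks) ⊛ (geometric k ⊛ f⁻¹)    ≈⟨ ⊛-interchange (𝟙 ⊖ X^ k) (∏𝟙⊖X ks) (geometric k) f⁻¹ ⟩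
    ((𝟙 ⊖ X^ k) ⊛ geometric k) ⊛ (∏𝟙⊖X ks ⊛ f⁻¹)    ≈⟨ ⊛-cong (𝟙⊖X-geometric k) inv ⟩
    𝟙 ⊛ 𝟙                                         ≈⟨ ⊛-identityˡ 𝟙 ⟩
    𝟙                                             ∎)
  where open ≈-Reasoning

⊛-solve : ∀ h {f g} ((h⁻¹ , _) : Invertible h) → h ⊛ f ≈ g → f ≈ h⁻¹ ⊛ g
⊛-solve h {f} {g} (h⁻¹ , inv) hf≈g = begin
  f                ≈⟨ ⊛-identityˡ f ⟨
  𝟙 ⊛ f            ≈⟨ ⊛-congʳ f inv ⟨
  (h ⊛ h⁻¹) ⊛ f    ≈⟨ ⊛-congʳ f (⊛-comm h h⁻¹) ⟩
  (h⁻¹ ⊛ h) ⊛ f    ≈⟨ ⊛-assoc h⁻¹ h f ⟩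
  h⁻¹ ⊛ (h ⊛ f)    ≈⟨ ⊛-congˡ h⁻¹ hf≈g ⟩
  h⁻¹ ⊛ g          ∎
  where open ≈-Reasoning

⊛-cancelˡ : ∀ h {f g} → Invertible h → h ⊛ f ≈ h ⊛ g → f ≈ g
⊛-cancelˡ h {g = g} inv hf≈hg =
  ≈-trans (⊛-solve h inv hf≈hg) (≈-sym (⊛-solve h inv (≈-refl {h ⊛ g})))

-- Coefficients, constant term first.
Poly : Set
Poly = List ℤ

⟦_⟧ : Poly → Series
⟦ []    ⟧ _       = 0ℤ
⟦ a ∷ p ⟧ zero    = a
⟦ a ∷ p ⟧ (suc n) = ⟦ p ⟧ n

infixl 6 _+ᴾ_ _-ᴾ_

_+ᴾ_ _-ᴾ_ : Poly → Poly → Poly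
[]      +ᴾ q       = q
(a ∷ p) +ᴾ []      = a ∷ p
(a ∷ p) +ᴾ (b ∷ q) = (a ℤ.+ b) ∷ (p +ᴾ q)
p       -ᴾ []      = p
[]      -ᴾ (b ∷ q) = ℤ.- b ∷ ([] -ᴾ q)
(a ∷ p) -ᴾ (b ∷ q) = (a ℤ.- b) ∷ (p -ᴾ q)

⟦+ᴾ⟧ : ∀ p q → ⟦ p +ᴾ q ⟧ ≈ ⟦ p ⟧ ⊕ ⟦ q ⟧
⟦+ᴾ⟧ []      q       n       = sym (ℤ.+-identityˡ _)
⟦+ᴾ⟧ (a ∷ p) []      n       = sym (ℤ.+-identityʳ _)
⟦+ᴾ⟧ (a ∷ p) (b ∷ q) zero    = refl
⟦+ᴾ⟧ (a ∷ p) (b ∷ q) (suc n) = ⟦+ᴾ⟧ p q n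

⟦-ᴾ⟧ : ∀ p q → ⟦ p -ᴾ q ⟧ ≈ ⟦ p ⟧ ⊖ ⟦ q ⟧
⟦-ᴾ⟧ []      []      n       = refl
⟦-ᴾ⟧ (a ∷ p) []      n       = sym (ℤ.+-identityʳ _)
⟦-ᴾ⟧ []      (b ∷ q) zero    = sym (ℤ.+-identityˡ _)
⟦-ᴾ⟧ []      (b ∷ q) (suc n) = ⟦-ᴾ⟧ [] q n
⟦-ᴾ⟧ (a ∷ p) (b ∷ q) zero    = refl
⟦-ᴾ⟧ (a ∷ p) (b ∷ q) (suc n) = ⟦-ᴾ⟧ p q n

shift : ℕ → Poly → Poly
shift zero    p = p
shift (suc k) p = 0ℤ ∷ shift k p

⟦shift⟧ : ∀ k p → ⟦ shift k p ⟧ ≈ X^ k ⊛ ⟦ p ⟧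
⟦shift⟧ zero    p n       = sym (⊛-identityˡ ⟦ p ⟧ n)
⟦shift⟧ (suc k) p zero    = refl
⟦shift⟧ (suc k) p (suc n) = trans (⟦shift⟧ k p n) (sym (X⊛-tail k ⟦ p ⟧ n))

times𝟙⊖X : ℕ → Poly → Poly
times𝟙⊖X k p = p -ᴾ shift k p

⟦times𝟙⊖X⟧ : ∀ k p → ⟦ times𝟙⊖X k p ⟧ ≈ (𝟙 ⊖ X^ k) ⊛ ⟦ p ⟧
⟦times𝟙⊖X⟧ k p n = begin
  ⟦ p -ᴾ shift k p ⟧ n            ≡⟨ ⟦-ᴾ⟧ p (shift k p) n ⟩
  ⟦ p ⟧ n ℤ.- ⟦ shift k p ⟧ n     ≡⟨ cong (ℤ._-_ (⟦ p ⟧ n)) (⟦shift⟧ k p n) ⟩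
  ⟦ p ⟧ n ℤ.- (X^ k ⊛ ⟦ p ⟧) n    ≡⟨ 𝟙⊖X-⊛ k ⟦ p ⟧ n ⟨
  ((𝟙 ⊖ X^ k) ⊛ ⟦ p ⟧) n          ∎
  where open ≡-Reasoning

times∏ : List ℕ → Poly → Poly
times∏ ks p = foldr times𝟙⊖X p ks

⟦times∏⟧ : ∀ ks p → ⟦ times∏ ks p ⟧ ≈ ∏𝟙⊖X ks ⊛ ⟦ p ⟧
⟦times∏⟧ []       p = ≈-sym (⊛-identityˡ ⟦ p ⟧)
⟦times∏⟧ (k ∷ ks) p = begin
  ⟦ times𝟙⊖X k (times∏ ks p) ⟧         ≈⟨ ⟦times𝟙⊖X⟧ k (times∏ ks p) ⟩
  (𝟙 ⊖ X^ k) ⊛ ⟦ times∏ ks p ⟧         ≈⟨ ⊛-congˡ (𝟙 ⊖ X^ k) (⟦times∏⟧ ks p) ⟩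
  (𝟙 ⊖ X^ k) ⊛ (∏𝟙⊖X ks ⊛ ⟦ p ⟧)      ≈⟨ ⊛-assoc (𝟙 ⊖ X^ k) (∏𝟙⊖X ks) ⟦ p ⟧ ⟨
  ((𝟙 ⊖ X^ k) ⊛ ∏𝟙⊖X ks) ⊛ ⟦ p ⟧      ∎
  where open ≈-Reasoning

-- Enumerations

open Equivalence using (to; from)

private variable
  A A′ : Set
  P : A → Set
  Q : A′ → Set

-- Two lists without repetition and with the same members are permutations of each other. Hence `Lᶜ`
-- may be computed from any other enumeration.
cardinality-unique : (d e : Enumeration P) → cardinality d ≡ cardinality e
cardinality-unique d e = ↭-length (∼bag⇒↭ (unique∧set⇒bag (unique d) (unique e)
  (λ {x} → ⇔-trans (complete d x) (⇔-sym (complete e x)))))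
  where open Enumeration

-- `f ∘ g` is the identity only where `Q` holds: the passage from squares to multiplicities takes
-- predecessors, which can be undone on positive entries only.
map-enumeration : (f : A → A′) (g : A′ → A) → (∀ a → g (f a) ≡ a) →
  (∀ {a} → P a → Q (f a)) → (∀ {b} → Q b → P (g b) × f (g b) ≡ b) →
  (e : Enumeration P) → Σ[ e′ ∈ Enumeration Q ] cardinality e′ ≡ cardinality e
map-enumeration {P = P} {Q = Q} f g g∘f P⇒Q Q⇒P e = record
  { list     = List.map f list
  ; unique   = Unique.map⁺ (λ {x} {y} fx≡fy → trans (sym (g∘f x)) (trans (cong g fx≡fy) (g∘f y))) unique
  ; complete = λ b → mk⇔
      (λ b∈ → let (a , a∈ , b≡fa) = ∈-map⁻ f b∈ in subst Q (sym b≡fa) (P⇒Q (to (complete a) a∈)))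
      (λ Qb → let (Pgb , fgb≡b) = Q⇒P Qb in
        subst (_∈ List.map f list) fgb≡b (∈-map⁺ f (from (complete (g b)) Pgb)))
  } , List.length-map f list
  where open Enumeration e

⊎-enumeration : (d : Enumeration P) (e : Enumeration Q) →
  Σ[ s ∈ Enumeration [ P , Q ]′ ] cardinality s ≡ cardinality d ℕ.+ cardinality e
⊎-enumeration {P = P} {Q = Q} d e = record
  { list     = ls ++ rs
  ; unique   = Unique.++⁺ (Unique.map⁺ inj₁-injective D.unique) (Unique.map⁺ inj₂-injective E.unique) disjoint
  ; complete = λ
      { (inj₁ a) → mk⇔ (λ x∈ → to (D.complete a) (left x∈))
                       (λ Pa → ∈-++⁺ˡ (∈-map⁺ inj₁ (from (D.complete a) Pa)))
      ; (inj₂ b) → mk⇔ (λ x∈ → to (E.complete b) (right x∈))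
                       (λ Qb → ∈-++⁺ʳ ls (∈-map⁺ inj₂ (from (E.complete b) Qb))) }
  } , trans (List.length-++ ls) (cong₂ ℕ._+_ (List.length-map inj₁ D.list) (List.length-map inj₂ E.list))
  where
  module D = Enumeration d
  module E = Enumeration e
  ls = List.map inj₁ D.list
  rs = List.map inj₂ E.list
  disjoint : ∀ {x} → ¬ (x ∈ ls × x ∈ rs)
  disjoint (x∈ls , x∈rs) with ∈-map⁻ inj₁ x∈ls | ∈-map⁻ inj₂ x∈rs
  ... | _ , _ , refl | _ , _ , ()
  left : ∀ {a} → inj₁ a ∈ ls ++ rs → a ∈ D.list
  left x∈ with ∈-++⁻ ls x∈
  ... | inj₁ x∈ls with ∈-map⁻ inj₁ x∈ls
  ...   | _ , a∈ , refl = a∈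
  left x∈ | inj₂ x∈rs with ∈-map⁻ inj₂ x∈rs
  ...   | _ , _ , ()
  right : ∀ {b} → inj₂ b ∈ ls ++ rs → b ∈ E.list
  right x∈ with ∈-++⁻ ls x∈
  ... | inj₂ x∈rs with ∈-map⁻ inj₂ x∈rs
  ...   | _ , b∈ , refl = b∈
  right x∈ | inj₁ x∈ls with ∈-map⁻ inj₁ x∈ls
  ...   | _ , _ , ()

empty-enumeration : (∀ a → ¬ P a) → Σ[ e ∈ Enumeration P ] cardinality e ≡ 0
empty-enumeration ¬P = record
  { list = [] ; unique = AllPairs.[] ; complete = λ a → mk⇔ (λ ()) (λ Pa → ⊥-elim (¬P a Pa)) } , refl

-- The enumerations are carried along with the series, so that finiteness for each `t` is
-- established together with the count.
Counts : (ℕ → A → Set) → Series → Set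
Counts P s = ∀ t → Σ[ e ∈ Enumeration (P t) ] + cardinality e ≡ s t

private variable
  F : ℕ → A → Set
  G : ℕ → A′ → Set
  r s : Series

Counts-map : (f : A → A′) (g : A′ → A) → (∀ a → g (f a) ≡ a) →
  (∀ {t a} → F t a → G t (f a)) → (∀ {t b} → G t b → F t (g b) × f (g b) ≡ b) →
  Counts F s → Counts G s
Counts-map f g g∘f F⇒G G⇒F c t =
  let (e , |e|≡) = c t
      (e′ , |e′|≡) = map-enumeration f g g∘f F⇒G G⇒F e
  in e′ , trans (cong +_ |e′|≡) |e|≡

Counts-⊎ : Counts F r → Counts G s → Counts (λ t → [ F t , G t ]′) (r ⊕ s)
Counts-⊎ c d t =
  let (e , |e|≡) = c t
      (e′ , |e′|≡) = d t
      (e″ , |e″|≡) = ⊎-enumeration e e′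
  in e″ , trans (cong +_ |e″|≡) (cong₂ ℤ._+_ |e|≡ |e′|≡)

Counts-empty : (∀ t a → ¬ F t a) → Counts F (λ _ → 0ℤ)
Counts-empty ¬F t = let (e , |e|≡0) = empty-enumeration (¬F t) in e , cong +_ |e|≡0

Counts-cong : r ≈ s → Counts F r → Counts F s
Counts-cong r≈s c t = let (e , |e|≡) = c t in e , trans |e|≡ (r≈s t)

-- Since multiplicities are positive, x stands for the multiplicity suc x.
weigh : ∀ {k} → Vec ℕ k → Vec ℕ k → ℕ
weigh []       []       = 0
weigh (w ∷ ws) (x ∷ xs) = suc x ℕ.* w ℕ.+ weigh ws xs

Weighing : ∀ {k} → Vec ℕ k → ℕ → Vec ℕ k → Set
Weighing ws t xs = weigh ws xs ≡ t

module _ {k} (w : ℕ) (ws : Vec ℕ k) where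
  -- Taking off one copy of the first generator either uses it up or lowers its multiplicity. This
  -- bijection is the combinatorial form of `r = x^w (s + r)`.
  peel : Vec ℕ k ⊎ Vec ℕ (suc k) → Vec ℕ (suc k)
  peel (inj₁ xs)       = 0 ∷ xs
  peel (inj₂ (x ∷ xs)) = suc x ∷ xs

  unpeel : Vec ℕ (suc k) → Vec ℕ k ⊎ Vec ℕ (suc k)
  unpeel (zero  ∷ xs) = inj₁ xs
  unpeel (suc x ∷ xs) = inj₂ (x ∷ xs)

  unpeel-peel : ∀ xs → unpeel (peel xs) ≡ xs
  unpeel-peel (inj₁ xs)       = refl
  unpeel-peel (inj₂ (x ∷ xs)) = refl

  peel-unpeel : ∀ xs → peel (unpeel xs) ≡ xs
  peel-unpeel (zero  ∷ xs) = refl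
  peel-unpeel (suc x ∷ xs) = refl

  weigh-zero : ∀ xs → weigh (w ∷ ws) (0 ∷ xs) ≡ w ℕ.+ weigh ws xs
  weigh-zero xs = cong (ℕ._+ weigh ws xs) (ℕ.*-identityˡ w)

  weigh-suc : ∀ x xs → weigh (w ∷ ws) (suc x ∷ xs) ≡ w ℕ.+ weigh (w ∷ ws) (x ∷ xs)
  weigh-suc x xs = ℕ.+-assoc w (suc x ℕ.* w) (weigh ws xs)

  Remainder : ℕ → Vec ℕ k ⊎ Vec ℕ (suc k) → Set
  Remainder t = [ Weighing ws t , Weighing (w ∷ ws) t ]′

  remainder⇒ : ∀ {t} xs → Remainder t xs → Weighing (w ∷ ws) (w ℕ.+ t) (peel xs)
  remainder⇒ (inj₁ xs)       refl = weigh-zero xs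
  remainder⇒ (inj₂ (x ∷ xs)) refl = weigh-suc x xs

  remainder⇐ : ∀ {t} xs → Weighing (w ∷ ws) (w ℕ.+ t) xs → Remainder t (unpeel xs)
  remainder⇐ (zero  ∷ xs) eq = ℕ.+-cancelˡ-≡ w _ _ (trans (sym (weigh-zero xs)) eq)
  remainder⇐ (suc x ∷ xs) eq = ℕ.+-cancelˡ-≡ w _ _ (trans (sym (weigh-suc x xs)) eq)

  weigh-≥ : ∀ xs → w ℕ.≤ weigh (w ∷ ws) xs
  weigh-≥ (x ∷ xs) = ℕ.≤-trans (ℕ.m≤m+n w (x ℕ.* w)) (ℕ.m≤m+n (suc x ℕ.* w) (weigh ws xs))

  -- The two hypotheses on `r` together say `r = x^w (s + r)`. As `w` is positive, peeling lowers
  -- the total weight, so the recursion on `t` is well-founded.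
  Counts-Weighing-∷ : .{{_ : NonZero w}} → Counts (Weighing ws) s →
    (∀ {t} → t ℕ.< w → r t ≡ 0ℤ) → (∀ t → r (w ℕ.+ t) ≡ s t ℤ.+ r t) → Counts (Weighing (w ∷ ws)) r
  Counts-Weighing-∷ {r = r} c r-below r-above = <-rec _ step
    where
    step : ∀ t → (∀ {u} → u ℕ.< t → Σ[ e ∈ Enumeration (Weighing (w ∷ ws) u) ] + cardinality e ≡ r u) →
      Σ[ e ∈ Enumeration (Weighing (w ∷ ws) t) ] + cardinality e ≡ r t
    step t rec with position w t
    ... | below t<w =
      let (e , |e|≡0) = empty-enumeration λ xs eq → ℕ.<⇒≱ t<w (subst (w ℕ.≤_) eq (weigh-≥ xs))
      in e , trans (cong +_ |e|≡0) (sym (r-below t<w))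
    ... | above u =
      let (d , |d|≡) = c u
          (e , |e|≡) = rec (ℕ.m<n+m u (ℕ.>-nonZero⁻¹ w))
          (s , |s|≡) = ⊎-enumeration d e
          (m , |m|≡) = map-enumeration peel unpeel unpeel-peel (λ {xs} → remainder⇒ xs)
                         (λ {xs} W → remainder⇐ xs W , peel-unpeel xs) s
      in m , trans (cong +_ (trans |m|≡ |s|≡)) (trans (cong₂ ℤ._+_ |d|≡ |e|≡) (sym (r-above u)))

-- Numerators over a common denominator

-- x^k / (1 - x^k), with a junk value at k = 0.
pole : ℕ → Series
pole zero      = λ _ → 0ℤ
pole k@(suc _) = X^ k ⊛ geometric k

𝟙⊖X-pole : ∀ k .{{_ : NonZero k}} → (𝟙 ⊖ X^ k) ⊛ pole k ≈ X^ k
𝟙⊖X-pole k@(suc _) = begin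
  (𝟙 ⊖ X^ k) ⊛ (X^ k ⊛ geometric k)    ≈⟨ ⊛-swap (𝟙 ⊖ X^ k) (X^ k) (geometric k) ⟩
  X^ k ⊛ ((𝟙 ⊖ X^ k) ⊛ geometric k)    ≈⟨ ⊛-congˡ (X^ k) (𝟙⊖X-geometric k) ⟩
  X^ k ⊛ 𝟙                             ≈⟨ ⊛-identityʳ (X^ k) ⟩
  X^ k                                 ∎
  where open ≈-Reasoning

𝟙⊖X-pole-⊛ : ∀ k .{{_ : NonZero k}} f → (𝟙 ⊖ X^ k) ⊛ (pole k ⊛ f) ≈ X^ k ⊛ f
𝟙⊖X-pole-⊛ k f =
  ≈-trans (≈-sym (⊛-assoc (𝟙 ⊖ X^ k) (pole k) f)) (⊛-congʳ f (𝟙⊖X-pole k))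

∏pole : List ℕ → Series
∏pole = foldr (λ k f → pole k ⊛ f) 𝟙

Counts-Weighing : ∀ {k} (ws : Vec ℕ k) → All NonZero (toList ws) → Counts (Weighing ws) (∏pole (toList ws))
Counts-Weighing []       []         = λ
  { zero    → record { list = [] ∷ [] ; unique = [] AllPairs.∷ AllPairs.[]
                     ; complete = λ { [] → mk⇔ (λ _ → refl) (λ _ → ListAny.here refl) } } , refl
  ; (suc t) → map₂ (cong +_) (empty-enumeration λ { [] () }) }
Counts-Weighing (w@(suc _) ∷ ws) (w≢0 ∷ nz) = Counts-Weighing-∷ w ws (Counts-Weighing ws nz)
  (λ {t} t<w → trans (⊛-assoc (X^ w) (geometric w) f t) (X⊛-below w (geometric w ⊛ f) t<w))
  above-w
  where
  f = ∏pole (toList ws)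
  g = pole w ⊛ f
  above-w : ∀ t → g (w ℕ.+ t) ≡ f t ℤ.+ g t
  above-w t = begin
    -- The recursion for `g` is the identity `(1 - x^w) g = x^w f` read in degree `w + t`.
    g (w ℕ.+ t)                                ≡⟨ a≡a-b+b (g (w ℕ.+ t)) (g t) ⟩
    (g (w ℕ.+ t) ℤ.- g t) ℤ.+ g t              ≡⟨ cong (ℤ._+ g t) (𝟙⊖X-above w g t) ⟨
    ((𝟙 ⊖ X^ w) ⊛ g) (w ℕ.+ t) ℤ.+ g t         ≡⟨ cong (ℤ._+ g t) (𝟙⊖X-pole-⊛ w f (w ℕ.+ t)) ⟩
    (X^ w ⊛ f) (w ℕ.+ t) ℤ.+ g t               ≡⟨ cong (ℤ._+ g t) (X⊛-above w f t) ⟩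
    f t ℤ.+ g t                                ∎
    where
    open ≡-Reasoning
    a≡a-b+b : ∀ a b → a ≡ (a ℤ.- b) ℤ.+ b
    a≡a-b+b = solve-∀

remove : ℕ → List ℕ → Maybe (List ℕ)
remove k []       = nothing
remove k (w ∷ ws) with k ℕ.≟ w
... | yes _ = just ws
... | no  _ = Maybe.map (w ∷_) (remove k ws)

map-just : ∀ {A B : Set} {f : A → B} {m y} → Maybe.map f m ≡ just y → ∃[ x ] m ≡ just x × f x ≡ y
map-just {m = just x} refl = x , refl , refl

remove-∏pole : ∀ k ws {ws′} → remove k ws ≡ just ws′ → ∏pole ws ≈ pole k ⊛ ∏pole ws′
remove-∏pole k (w ∷ ws) eq with k ℕ.≟ w
remove-∏pole k (w ∷ ws) refl | yes refl = ≈-refl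
remove-∏pole k (w ∷ ws) eq   | no _ with map-just {m = remove k ws} eq
... | ws′ , eq′ , refl = ≈-trans (⊛-congˡ (pole w) (remove-∏pole k ws eq′)) (⊛-swap (pole w) (pole k) (∏pole ws′))

remove-nonZero : ∀ k ws {ws′} → NonZero k → remove k ws ≡ just ws′ → All NonZero ws′ → All NonZero ws
remove-nonZero k (w ∷ ws) k≢0 eq nz with k ℕ.≟ w
remove-nonZero k (w ∷ ws) k≢0 refl nz | yes refl = k≢0 ∷ nz
remove-nonZero k (w ∷ ws) k≢0 eq   nz | no _ with map-just {m = remove k ws} eq
remove-nonZero k (w ∷ ws) k≢0 eq (w≢0 ∷ nz) | no _ | _ , eq′ , refl = w≢0 ∷ remove-nonZero k ws k≢0 eq′ nz

-- The numerator of ∏pole ws over the common denominator ∏𝟙⊖X ks.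
numerator : List ℕ → List ℕ → Maybe Poly
numerator []       []      = just (1ℤ ∷ [])
numerator []       (_ ∷ _) = nothing
numerator (k ∷ ks) ws with remove k ws
... | just ws′ = Maybe.map (shift k) (numerator ks ws′)
... | nothing  = Maybe.map (times𝟙⊖X k) (numerator ks ws)

⟦1⟧ : ⟦ 1ℤ ∷ [] ⟧ ≈ 𝟙
⟦1⟧ zero    = refl
⟦1⟧ (suc n) = refl

-- Each factor `1 - x^k` either cancels a pole of weight `k`, leaving `x^k`, or passes into the
-- numerator. A pole left without a factor makes `numerator` return `nothing`, so success means that
-- all of them were cancelled.
numerator-sound : ∀ {ks} → All NonZero ks → ∀ ws {p} → numerator ks ws ≡ just p →
  ∏𝟙⊖X ks ⊛ ∏pole ws ≈ ⟦ p ⟧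
numerator-sound []         []      refl = ≈-trans (⊛-identityˡ 𝟙) (≈-sym ⟦1⟧)
numerator-sound {k ∷ ks} (k≢0 ∷ nz) ws eq with remove k ws in removed
... | just ws′ with p , eq′ , refl ← map-just {m = numerator ks ws′} eq = begin
  ((𝟙 ⊖ X^ k) ⊛ ∏𝟙⊖X ks) ⊛ ∏pole ws              ≈⟨ ⊛-congˡ ((𝟙 ⊖ X^ k) ⊛ ∏𝟙⊖X ks) (remove-∏pole k ws removed) ⟩
  ((𝟙 ⊖ X^ k) ⊛ ∏𝟙⊖X ks) ⊛ (pole k ⊛ ∏pole ws′)  ≈⟨ ⊛-interchange (𝟙 ⊖ X^ k) (∏𝟙⊖X ks) (pole k) (∏pole ws′) ⟩
  ((𝟙 ⊖ X^ k) ⊛ pole k) ⊛ (∏𝟙⊖X ks ⊛ ∏pole ws′)  ≈⟨ ⊛-cong (𝟙⊖X-pole k {{k≢0}}) (numerator-sound nz ws′ eq′) ⟩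
  X^ k ⊛ ⟦ p ⟧                                  ≈⟨ ⟦shift⟧ k p ⟨
  ⟦ shift k p ⟧                                 ∎
  where open ≈-Reasoning
... | nothing  with p , eq′ , refl ← map-just {m = numerator ks ws} eq = begin
  ((𝟙 ⊖ X^ k) ⊛ ∏𝟙⊖X ks) ⊛ ∏pole ws              ≈⟨ ⊛-assoc (𝟙 ⊖ X^ k) (∏𝟙⊖X ks) (∏pole ws) ⟩
  (𝟙 ⊖ X^ k) ⊛ (∏𝟙⊖X ks ⊛ ∏pole ws)              ≈⟨ ⊛-congˡ (𝟙 ⊖ X^ k) (numerator-sound nz ws eq′) ⟩
  (𝟙 ⊖ X^ k) ⊛ ⟦ p ⟧                            ≈⟨ ⟦times𝟙⊖X⟧ k p ⟨
  ⟦ times𝟙⊖X k p ⟧                              ∎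
  where open ≈-Reasoning

-- A successful computation has matched every weight with an element of `ks`, which supplies the
-- positivity that finite counts require.
numerator-nonZero : ∀ {ks} → All NonZero ks → ∀ ws {p} → numerator ks ws ≡ just p → All NonZero ws
numerator-nonZero []         [] eq = []
numerator-nonZero {k ∷ ks} (k≢0 ∷ nz) ws eq with remove k ws in removed
... | just ws′ = let (_ , eq′ , _) = map-just {m = numerator ks ws′} eq in
  remove-nonZero k ws k≢0 removed (numerator-nonZero nz ws′ eq′)
... | nothing  = let (_ , eq′ , _) = map-just {m = numerator ks ws} eq in numerator-nonZero nz ws eq′

-- Elliott's decomposition of linear Diophantine systems

private variable
  d k : ℕ

data Kind : Set where
  any equals less-than distinct : Kind

Related : Kind → ℕ → ℕ → Set
Related any       _ _ = ⊤
Related equals    a b = a ≡ b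
Related less-than a b = a ℕ.< b
Related distinct  a b = a ≢ b

infix 6 _⟨_⟩_

-- Both sides are sums of coordinates, given by lists of indices, so all comparisons stay within the
-- natural numbers.
record Constraint (d : ℕ) : Set where
  constructor _⟨_⟩_
  field
    lhs  : List (Fin d)
    kind : Kind
    rhs  : List (Fin d)

open Constraint

Point : ℕ → Set
Point = Vec ℕ

infixl 6 _⊞_
_⊞_ : Point d → Point d → Point d
_⊞_ = zipWith ℕ._+_

total : List (Fin d) → Point d → ℕ
total is g = foldr (λ i s → lookup g i ℕ.+ s) 0 is

Additive : (Point d → ℕ) → Set
Additive φ = ∀ g h → φ (g ⊞ h) ≡ φ g ℕ.+ φ h

lookup-additive : (i : Fin d) → Additive (λ g → lookup g i)
lookup-additive i = lookup-zipWith ℕ._+_ i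

total-additive : (is : List (Fin d)) → Additive (total is)
total-additive []       g h = refl
total-additive (i ∷ is) g h = trans
  (cong₂ ℕ._+_ (lookup-additive i g h) (total-additive is g h))
  (regroup (lookup g i) (lookup h i) (total is g) (total is h))
  where
  regroup : ∀ a b c d → a ℕ.+ b ℕ.+ (c ℕ.+ d) ≡ a ℕ.+ c ℕ.+ (b ℕ.+ d)
  regroup = solve-∀-ℕ

-- For additive `φ` this is `φ` at the positive combination of `gs` that `xs` describes, obtained
-- without forming that point.
value : (Point d → ℕ) → Vec (Point d) k → Vec ℕ k → ℕ
value φ gs xs = weigh (Vec.map φ gs) xs

module _ {A : Set} where
  pull : Fin (suc k) → Vec A (suc k) → Vec A (suc k)
  pull i xs = lookup xs i ∷ removeAt xs i

  push : Fin (suc k) → Vec A (suc k) → Vec A (suc k)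
  push i (x ∷ xs) = insertAt xs i x

  push-pull : (i : Fin (suc k)) (xs : Vec A (suc k)) → push i (pull i xs) ≡ xs
  push-pull i xs = insertAt-removeAt xs i

  pull-push : (i : Fin (suc k)) (xs : Vec A (suc k)) → pull i (push i xs) ≡ xs
  pull-push i (x ∷ xs) = cong₂ _∷_ (insertAt-lookup xs i x) (removeAt-insertAt xs i x)

  removeAt-suc : ∀ x (xs : Vec A (suc k)) i → removeAt (x ∷ xs) (suc i) ≡ x ∷ removeAt xs i
  removeAt-suc x (_ ∷ _) i = refl

value-pull : (φ : Point d → ℕ) (i : Fin (suc k)) (gs : Vec (Point d) (suc k)) (xs : Vec ℕ (suc k)) →
  value φ (pull i gs) (pull i xs) ≡ value φ gs xs
value-pull φ zero    (g ∷ gs)      (x ∷ xs)      = refl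
value-pull φ (suc i) (g ∷ gs@(_ ∷ _)) (x ∷ xs@(_ ∷ _)) = trans
  (regroup (suc (lookup xs i) ℕ.* φ (lookup gs i)) (suc x ℕ.* φ g) (value φ (removeAt gs i) (removeAt xs i)))
  (cong (suc x ℕ.* φ g ℕ.+_) (value-pull φ i gs xs))
  where
  regroup : ∀ a b c → a ℕ.+ (b ℕ.+ c) ≡ b ℕ.+ (a ℕ.+ c)
  regroup = solve-∀-ℕ

-- A combination of g and h either has equal multiplicities, and is a multiple of
-- g ⊞ h, or it is a combination of g ⊞ h with the generator of larger multiplicity.
Merged : ℕ → Set
Merged k = Vec ℕ (suc k) ⊎ (Vec ℕ (suc (suc k)) ⊎ Vec ℕ (suc (suc k)))

merge : Merged k → Vec ℕ (suc (suc k))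
merge (inj₁ (m ∷ xs))            = m ∷ m ∷ xs
-- The true multiplicities are `m + 1` and `m + n + 2`: the smaller one goes to `g ⊞ h`, and the
-- difference `n + 1`, stored as `n`, to the other generator.
merge (inj₂ (inj₁ (n ∷ m ∷ xs))) = m ∷ suc (m ℕ.+ n) ∷ xs
merge (inj₂ (inj₂ (n ∷ m ∷ xs))) = suc (m ℕ.+ n) ∷ m ∷ xs

unmerge : Vec ℕ (suc (suc k)) → Merged k
unmerge (a ∷ b ∷ xs) with compare a b
... | equal m     = inj₁ (m ∷ xs)
... | less m n    = inj₂ (inj₁ (n ∷ m ∷ xs))
... | greater m n = inj₂ (inj₂ (n ∷ m ∷ xs))

merge-unmerge : (xs : Vec ℕ (suc (suc k))) → merge (unmerge xs) ≡ xs
merge-unmerge (a ∷ b ∷ xs) with compare a b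
... | equal m     = refl
... | less m n    = refl
... | greater m n = refl

compare-equal : ∀ m → compare m m ≡ equal m
compare-equal zero    = refl
compare-equal (suc m) rewrite compare-equal m = refl

compare-less : ∀ m n → compare m (suc (m ℕ.+ n)) ≡ less m n
compare-less zero    n = refl
compare-less (suc m) n rewrite compare-less m n = refl

compare-greater : ∀ m n → compare (suc (m ℕ.+ n)) m ≡ greater m n
compare-greater zero    n = refl
compare-greater (suc m) n rewrite compare-greater m n = refl

-- By trichotomy the three new families of multiplicities are disjoint and cover the old one, so
-- their counts add up without correction terms.
unmerge-merge : (xs : Merged k) → unmerge (merge xs) ≡ xs
unmerge-merge (inj₁ (m ∷ xs))            rewrite compare-equal m = refl
unmerge-merge (inj₂ (inj₁ (n ∷ m ∷ xs))) rewrite compare-less m n = refl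
unmerge-merge (inj₂ (inj₂ (n ∷ m ∷ xs))) rewrite compare-greater m n = refl

module _ (φ : Point d → ℕ) (add : Additive φ) (g h : Point d) (gs : Vec (Point d) k) where
  value-equal : ∀ xs → value φ (g ⊞ h ∷ gs) xs ≡ value φ (g ∷ h ∷ gs) (merge (inj₁ xs))
  value-equal (m ∷ xs) rewrite add g h = regroup m (φ g) (φ h) (value φ gs xs)
    where
    regroup : ∀ m a b c → suc m ℕ.* (a ℕ.+ b) ℕ.+ c ≡ suc m ℕ.* a ℕ.+ (suc m ℕ.* b ℕ.+ c)
    regroup = solve-∀-ℕ

  value-less : ∀ xs → value φ (h ∷ g ⊞ h ∷ gs) xs ≡ value φ (g ∷ h ∷ gs) (merge (inj₂ (inj₁ xs)))
  value-less (n ∷ m ∷ xs) rewrite add g h = regroup m n (φ g) (φ h) (value φ gs xs)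
    where
    regroup : ∀ m n a b c → suc n ℕ.* b ℕ.+ (suc m ℕ.* (a ℕ.+ b) ℕ.+ c)
      ≡ suc m ℕ.* a ℕ.+ (suc (suc (m ℕ.+ n)) ℕ.* b ℕ.+ c)
    regroup = solve-∀-ℕ

  value-greater : ∀ xs → value φ (g ∷ g ⊞ h ∷ gs) xs ≡ value φ (g ∷ h ∷ gs) (merge (inj₂ (inj₂ xs)))
  value-greater (n ∷ m ∷ xs) rewrite add g h = regroup m n (φ g) (φ h) (value φ gs xs)
    where
    regroup : ∀ m n a b c → suc n ℕ.* a ℕ.+ (suc m ℕ.* (a ℕ.+ b) ℕ.+ c)
      ≡ suc (suc (m ℕ.+ n)) ℕ.* a ℕ.+ (suc m ℕ.* b ℕ.+ c)
    regroup = solve-∀-ℕ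

module _ (φ ψ : Point d → ℕ) where
  value-≤ : (gs : Vec (Point d) k) → ¬ Any (λ g → ψ g ℕ.< φ g) gs → ∀ xs → value φ gs xs ℕ.≤ value ψ gs xs
  value-≤ []       _  []       = z≤n
  value-≤ (g ∷ gs) ¬fall (x ∷ xs) =
    ℕ.+-mono-≤ (ℕ.*-monoʳ-≤ (suc x) (ℕ.≮⇒≥ (¬fall ∘ here))) (value-≤ gs (¬fall ∘ there) xs)

  -- One strict generator suffices because every multiplicity is positive: the cones are open, and
  -- the faces where strictness could be lost do not belong to them.
  value-< : (gs : Vec (Point d) k) → Any (λ g → φ g ℕ.< ψ g) gs → ¬ Any (λ g → ψ g ℕ.< φ g) gs →
    ∀ xs → value φ gs xs ℕ.< value ψ gs xs
  value-< (g ∷ gs) (here φ<ψ) ¬fall (x ∷ xs) =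
    ℕ.+-mono-<-≤ (ℕ.*-monoʳ-< (suc x) φ<ψ) (value-≤ gs (¬fall ∘ there) xs)
  value-< (g ∷ gs) (there rise) ¬fall (x ∷ xs) =
    ℕ.+-mono-≤-< (ℕ.*-monoʳ-≤ (suc x) (ℕ.≮⇒≥ (¬fall ∘ here))) (value-< gs rise (¬fall ∘ there) xs)

data Trend : Set where
  rising level falling : Trend

Ordered : Trend → ℕ → ℕ → Set
Ordered rising  a b = a ℕ.< b
Ordered level   a b = a ≡ b
Ordered falling a b = b ℕ.< a

decide : ∀ r o → (∀ {a b} → Ordered o a b → Related r a b) ⊎ (∀ {a b} → Ordered o a b → ¬ Related r a b)
decide any       o       = inj₁ λ _ → tt
decide equals    rising  = inj₂ ℕ.<⇒≢
decide equals    level   = inj₁ id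
decide equals    falling = inj₂ (λ b<a → ℕ.<⇒≢ b<a ∘ sym)
decide less-than rising  = inj₁ id
decide less-than level   = inj₂ λ { refl → ℕ.<-irrefl refl }
decide less-than falling = inj₂ ℕ.<-asym
decide distinct  rising  = inj₁ ℕ.<⇒≢
decide distinct  level   = inj₂ λ a≡b a≢b → a≢b a≡b
decide distinct  falling = inj₁ (λ b<a → ℕ.<⇒≢ b<a ∘ sym)

module Elimination (d : ℕ) (weight : Fin d) where
  Holds : Vec (Point d) k → Vec ℕ k → Constraint d → Set
  Holds gs xs c = Related (kind c) (value (total (lhs c)) gs xs) (value (total (rhs c)) gs xs)

  record Solution (cs : List (Constraint d)) (gs : Vec (Point d) k) (t : ℕ) (xs : Vec ℕ k) : Set where
    constructor solution
    field
      constraints : All (Holds gs xs) cs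
      weighted    : value (λ g → lookup g weight) gs xs ≡ t

  open Solution

  -- Both sides of every constraint and the weight are additive functions, so combinations related
  -- in this way solve the same systems with the same weight.
  SameValues : ∀ {k l} → Vec (Point d) k → Vec ℕ k → Vec (Point d) l → Vec ℕ l → Set
  SameValues gs xs hs ys = ∀ φ → Additive φ → value φ gs xs ≡ value φ hs ys

  Solution-resp : ∀ {l t cs} {gs : Vec (Point d) k} {xs} {hs : Vec (Point d) l} {ys} →
    SameValues gs xs hs ys → Solution cs gs t xs → Solution cs hs t ys
  Solution-resp same (solution holds eq) = solution
    (All.map (λ {c} → subst₂ (Related (kind c)) (same _ (total-additive (lhs c))) (same _ (total-additive (rhs c)))) holds)
    (trans (sym (same _ (lookup-additive weight))) eq)

  Rises Falls : Constraint d → Point d → Set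
  Rises c g = total (lhs c) g ℕ.< total (rhs c) g
  Falls c g = total (rhs c) g ℕ.< total (lhs c) g

  rises? : (c : Constraint d) (gs : Vec (Point d) k) → Dec (Any (Rises c) gs)
  rises? c = any? λ g → total (lhs c) g ℕ.<? total (rhs c) g

  falls? : (c : Constraint d) (gs : Vec (Point d) k) → Dec (Any (Falls c) gs)
  falls? c = any? λ g → total (rhs c) g ℕ.<? total (lhs c) g

  infixl 6 _+ᴹ_
  _+ᴹ_ : Maybe Poly → Maybe Poly → Maybe Poly
  _+ᴹ_ = Maybe.zipWith _+ᴾ_

  module _ (ks : List ℕ) where
    -- The first argument of eliminate is fuel; nothing is returned when it runs out.
    mutual
      eliminate : ℕ → List (Constraint d) → Vec (Point d) k → Maybe Poly
      eliminate n       []       gs = numerator ks (toList (Vec.map (λ g → lookup g weight) gs))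
      eliminate zero    (c ∷ cs) gs = nothing
      eliminate (suc n) (c ∷ cs) gs = findRise n c cs gs (rises? c gs)

      findRise : ℕ → (c : Constraint d) → List (Constraint d) → (gs : Vec (Point d) k) →
        Dec (Any (Rises c) gs) → Maybe Poly
      findRise         n c cs gs (no _)  = noRise n c cs gs (falls? c gs)
      findRise {suc k} n c cs gs (yes i) = findFall n c cs gs (lookup gs (index i)) (removeAt gs (index i))
                                             (falls? c (removeAt gs (index i)))

      findFall : ℕ → (c : Constraint d) → List (Constraint d) → Vec (Point d) (suc k) →
        (g : Point d) (gs : Vec (Point d) k) → Dec (Any (Falls c) gs) → Maybe Poly
      findFall         n c cs gs _ _  (no _)  = settle n c cs gs rising
      -- `c` is kept in the list, since the new cones may still have generators on both sides of it.
      findFall {suc k} n c cs _  g gs (yes j) = split n (c ∷ cs) (lookup gs (index j)) g (removeAt gs (index j))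

      noRise : ℕ → (c : Constraint d) → List (Constraint d) → (gs : Vec (Point d) k) →
        Dec (Any (Falls c) gs) → Maybe Poly
      noRise n c cs gs (yes _) = settle n c cs gs falling
      noRise n c cs gs (no _)  = settle n c cs gs level

      settle : ℕ → Constraint d → List (Constraint d) → Vec (Point d) k → Trend → Maybe Poly
      settle n c cs gs o with decide (kind c) o
      ... | inj₁ _ = eliminate n cs gs
      -- A cone without solutions contributes the zero numerator; `nothing` is reserved for failure.
      ... | inj₂ _ = just []

      split : ℕ → List (Constraint d) → Point d → Point d → Vec (Point d) k → Maybe Poly
      split n cs g h gs =
        eliminate n cs (g ⊞ h ∷ gs) +ᴹ (eliminate n cs (h ∷ g ⊞ h ∷ gs) +ᴹ eliminate n cs (g ∷ g ⊞ h ∷ gs))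

    module _ (nz : All NonZero ks) where
      denominator⁻¹ : Series
      denominator⁻¹ = proj₁ (∏𝟙⊖X-invertible nz)

      CountedBy : (ℕ → Vec ℕ k → Set) → Poly → Set
      CountedBy F p = Counts F (denominator⁻¹ ⊛ ⟦ p ⟧)

      +ᴹ-just : ∀ m n {r} → m +ᴹ n ≡ just r → ∃[ p ] ∃[ q ] m ≡ just p × n ≡ just q × r ≡ p +ᴾ q
      +ᴹ-just (just p) (just q) refl = p , q , refl , refl , refl

      -- Reordering generators together with their multiplicities preserves all values. It serves to
      -- bring the two generators of a split to the front.
      pull-sound : ∀ {cs p} i (gs : Vec (Point d) (suc k)) →
        CountedBy (Solution cs (pull i gs)) p → CountedBy (Solution cs gs) p
      pull-sound i gs = Counts-map (push i) (pull i) (pull-push i)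
        (λ {_} {xs} → Solution-resp λ φ _ → trans (cong (value φ (pull i gs)) (sym (pull-push i xs)))
          (value-pull φ i gs (push i xs)))
        (λ {_} {xs} sol → Solution-resp (λ φ _ → sym (value-pull φ i gs xs)) sol , push-pull i xs)

      mutual
        eliminate-sound : ∀ n cs (gs : Vec (Point d) k) {p} → eliminate n cs gs ≡ just p → CountedBy (Solution cs gs) p
        eliminate-sound n       []       gs {p} eq = Counts-map id id (λ _ → refl)
          (solution []) (λ sol → weighted sol , refl)
          (Counts-cong (⊛-solve (∏𝟙⊖X ks) (∏𝟙⊖X-invertible nz) (numerator-sound nz ws eq))
            (Counts-Weighing (Vec.map (λ g → lookup g weight) gs) (numerator-nonZero nz ws eq)))
          where
          ws = toList (Vec.map (λ g → lookup g weight) gs)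
        eliminate-sound (suc n) (c ∷ cs) gs = findRise-sound n c cs gs (rises? c gs)

        findRise-sound : ∀ n c cs (gs : Vec (Point d) k) r {p} → findRise n c cs gs r ≡ just p →
          CountedBy (Solution (c ∷ cs) gs) p
        findRise-sound {suc k} n c cs gs (yes i) eq =
          findFall-sound n c cs gs (index i) (lookup-index i) (falls? c (removeAt gs (index i))) eq
        findRise-sound n c cs gs (no ¬r) eq = noRise-sound n c cs gs ¬r (falls? c gs) eq

        findFall-sound : ∀ n c cs (gs : Vec (Point d) (suc k)) i → Rises c (lookup gs i) → ∀ f {p} →
          findFall n c cs gs (lookup gs i) (removeAt gs i) f ≡ just p → CountedBy (Solution (c ∷ cs) gs) p
        findFall-sound {suc k} n c cs gs i _ (yes j) {p} eq =
          -- The rising generator is moved to the front first and the falling one then past it, so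
          -- the position of the latter is shifted by one.
          pull-sound {p = p} i gs (pull-sound {p = p} (suc (index j)) (pull i gs)
            (subst (λ hs → CountedBy (Solution (c ∷ cs) (h ∷ hs)) p) (sym (removeAt-suc (lookup gs i) rest (index j)))
              (split-sound n (c ∷ cs) h (lookup gs i) (removeAt rest (index j)) eq)))
          where
          rest = removeAt gs i
          h = lookup rest (index j)
        findFall-sound n c cs gs i r (no ¬f) eq = settle-sound n c cs gs rising
          (λ xs → subst₂ ℕ._<_ (value-pull (total (lhs c)) i gs xs) (value-pull (total (rhs c)) i gs xs)
            (value-< (total (lhs c)) (total (rhs c)) (pull i gs) (here r)
              (λ { (here f) → ℕ.<-asym r f ; (there f) → ¬f f }) (pull i xs)))
          eq

        noRise-sound : ∀ n c cs (gs : Vec (Point d) k) → ¬ Any (Rises c) gs → ∀ f {p} →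
          noRise n c cs gs f ≡ just p → CountedBy (Solution (c ∷ cs) gs) p
        noRise-sound n c cs gs ¬r (yes f) eq = settle-sound n c cs gs falling
          (value-< (total (rhs c)) (total (lhs c)) gs f ¬r) eq
        noRise-sound n c cs gs ¬r (no ¬f) eq = settle-sound n c cs gs level
          (λ xs → ℕ.≤-antisym (value-≤ (total (lhs c)) (total (rhs c)) gs ¬f xs)
            (value-≤ (total (rhs c)) (total (lhs c)) gs ¬r xs)) eq

        settle-sound : ∀ n c cs (gs : Vec (Point d) k) o →
          (∀ xs → Ordered o (value (total (lhs c)) gs xs) (value (total (rhs c)) gs xs)) →
          ∀ {p} → settle n c cs gs o ≡ just p → CountedBy (Solution (c ∷ cs) gs) p
        settle-sound n c cs gs o ordered eq with decide (kind c) o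
        ... | inj₁ related = Counts-map id id (λ _ → refl)
          (λ {_} {xs} (solution holds eq) → solution (related (ordered xs) ∷ holds) eq)
          (λ { (solution (_ ∷ holds) eq) → solution holds eq , refl }) (eliminate-sound n cs gs eq)
        settle-sound n c cs gs o ordered refl | inj₂ ¬related =
          Counts-cong (λ n → sym (trans (⊛-comm denominator⁻¹ ⟦ [] ⟧ n) (⊛-zeroˡ denominator⁻¹ n)))
            (Counts-empty λ { t xs (solution (holds ∷ _) _) → ¬related (ordered xs) holds })

        split-sound : ∀ n cs g h (gs : Vec (Point d) k) {p} → split n cs g h gs ≡ just p →
          CountedBy (Solution cs (g ∷ h ∷ gs)) p
        split-sound n cs g h gs eq
          with p , p′ , eq₁ , eq′ , refl ← +ᴹ-just (eliminate n cs (g ⊞ h ∷ gs)) _ eq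
          with q , r , eq₂ , eq₃ , refl ← +ᴹ-just (eliminate n cs (h ∷ g ⊞ h ∷ gs)) _ eq′ =
          Counts-map merge unmerge unmerge-merge (λ {_} {xs} → forth xs) (λ {_} {xs} sol → back sol , merge-unmerge xs)
            (Counts-cong (λ m → sym (expand p q r m))
              (Counts-⊎ (eliminate-sound n cs (g ⊞ h ∷ gs) eq₁)
                (Counts-⊎ (eliminate-sound n cs (h ∷ g ⊞ h ∷ gs) eq₂) (eliminate-sound n cs (g ∷ g ⊞ h ∷ gs) eq₃))))
          where
          Parts : ℕ → Merged _ → Set
          Parts t = [ Solution cs (g ⊞ h ∷ gs) t , [ Solution cs (h ∷ g ⊞ h ∷ gs) t , Solution cs (g ∷ g ⊞ h ∷ gs) t ]′ ]′
          forth : ∀ {t} xs → Parts t xs → Solution cs (g ∷ h ∷ gs) t (merge xs)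
          forth (inj₁ xs)        = Solution-resp λ φ add → value-equal φ add g h gs xs
          forth (inj₂ (inj₁ xs)) = Solution-resp λ φ add → value-less φ add g h gs xs
          forth (inj₂ (inj₂ xs)) = Solution-resp λ φ add → value-greater φ add g h gs xs
          parts : ∀ {t} xs → Solution cs (g ∷ h ∷ gs) t (merge xs) → Parts t xs
          parts (inj₁ xs)        = Solution-resp λ φ add → sym (value-equal φ add g h gs xs)
          parts (inj₂ (inj₁ xs)) = Solution-resp λ φ add → sym (value-less φ add g h gs xs)
          parts (inj₂ (inj₂ xs)) = Solution-resp λ φ add → sym (value-greater φ add g h gs xs)
          back : ∀ {t xs} → Solution cs (g ∷ h ∷ gs) t xs → Parts t (unmerge xs)
          back {t} {xs} sol = parts (unmerge xs) (subst (Solution cs (g ∷ h ∷ gs) t) (sym (merge-unmerge xs)) sol)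
          expand : ∀ p q r → denominator⁻¹ ⊛ ⟦ p +ᴾ (q +ᴾ r) ⟧
            ≈ denominator⁻¹ ⊛ ⟦ p ⟧ ⊕ (denominator⁻¹ ⊛ ⟦ q ⟧ ⊕ denominator⁻¹ ⊛ ⟦ r ⟧)
          expand p q r = begin
            denominator⁻¹ ⊛ ⟦ p +ᴾ (q +ᴾ r) ⟧
              ≈⟨ ⊛-congˡ denominator⁻¹ (≈-trans (⟦+ᴾ⟧ p (q +ᴾ r)) (⊕-cong (≈-refl {⟦ p ⟧}) (⟦+ᴾ⟧ q r))) ⟩
            denominator⁻¹ ⊛ (⟦ p ⟧ ⊕ (⟦ q ⟧ ⊕ ⟦ r ⟧))
              ≈⟨ ⊛-distribˡ-⊕ denominator⁻¹ ⟦ p ⟧ (⟦ q ⟧ ⊕ ⟦ r ⟧) ⟩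
            denominator⁻¹ ⊛ ⟦ p ⟧ ⊕ denominator⁻¹ ⊛ (⟦ q ⟧ ⊕ ⟦ r ⟧)
              ≈⟨ ⊕-cong (≈-refl {denominator⁻¹ ⊛ ⟦ p ⟧}) (⊛-distribˡ-⊕ denominator⁻¹ ⟦ q ⟧ ⟦ r ⟧) ⟩
            denominator⁻¹ ⊛ ⟦ p ⟧ ⊕ (denominator⁻¹ ⊛ ⟦ q ⟧ ⊕ denominator⁻¹ ⊛ ⟦ r ⟧) ∎
            where open ≈-Reasoning

-- Magilatin squares as solutions of a system

value-zero : (gs : Vec (Point d) k) (xs : Vec ℕ k) → value (λ _ → 0) gs xs ≡ 0
value-zero []       []       = refl
value-zero (g ∷ gs) (x ∷ xs) = cong₂ ℕ._+_ (ℕ.*-zeroʳ (suc x)) (value-zero gs xs)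

value-+ : (φ ψ : Point d → ℕ) (gs : Vec (Point d) k) (xs : Vec ℕ k) →
  value (λ g → φ g ℕ.+ ψ g) gs xs ≡ value φ gs xs ℕ.+ value ψ gs xs
value-+ φ ψ []       []       = refl
value-+ φ ψ (g ∷ gs) (x ∷ xs) rewrite value-+ φ ψ gs xs =
  regroup (suc x) (φ g) (ψ g) (value φ gs xs) (value ψ gs xs)
  where
  regroup : ∀ x a b c d → x ℕ.* (a ℕ.+ b) ℕ.+ (c ℕ.+ d) ≡ x ℕ.* a ℕ.+ c ℕ.+ (x ℕ.* b ℕ.+ d)
  regroup = solve-∀-ℕ

value-map : ∀ {l} (φ : Point d → ℕ) (χ : Point l → Point d) (gs : Vec (Point l) k) (xs : Vec ℕ k) →
  value φ (Vec.map χ gs) xs ≡ value (φ ∘ χ) gs xs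
value-map φ χ []       []       = refl
value-map φ χ (g ∷ gs) (x ∷ xs) = cong (suc x ℕ.* φ (χ g) ℕ.+_) (value-map φ χ gs xs)

units : ∀ d → Vec (Point d) d
units zero    = []
units (suc d) = (1 ∷ replicate d 0) ∷ Vec.map (0 ∷_) (units d)

-- The open cone on the unit vectors consists of all points with positive coordinates, and the
-- stored multiplicities are those coordinates minus one.
lookup-units : (i : Fin d) (xs : Vec ℕ d) → value (λ g → lookup g i) (units d) xs ≡ lookup (Vec.map suc xs) i
lookup-units {suc d} zero    (x ∷ xs) = trans
  (cong₂ ℕ._+_ (ℕ.*-identityʳ (suc x)) (trans (value-map (λ g → lookup g zero) (0 ∷_) (units d) xs) (value-zero (units d) xs)))
  (ℕ.+-identityʳ (suc x))
lookup-units {suc d} (suc i) (x ∷ xs) = cong₂ ℕ._+_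
  (trans (cong (suc x ℕ.*_) (lookup-replicate i 0)) (ℕ.*-zeroʳ (suc x)))
  (trans (value-map (λ g → lookup g (suc i)) (0 ∷_) (units d) xs) (lookup-units i xs))

total-units : (is : List (Fin d)) (xs : Vec ℕ d) → value (total is) (units d) xs ≡ total is (Vec.map suc xs)
total-units {d} []       xs = value-zero (units d) xs
total-units {d} (i ∷ is) xs = trans
  (value-+ (λ g → lookup g i) (total is) (units d) xs)
  (cong₂ ℕ._+_ (lookup-units i xs) (total-units is xs))

Satisfies : Vec ℕ d → Constraint d → Set
Satisfies v c = Related (kind c) (total (lhs c) v) (total (rhs c) v)

-- Coordinates: the bound t, followed by the entries of the square.
pattern bound = zero
pattern m₁₁ = suc bound
pattern m₁₂ = suc m₁₁
pattern m₁₃ = suc m₁₂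
pattern m₂₁ = suc m₁₃
pattern m₂₂ = suc m₂₁
pattern m₂₃ = suc m₂₂
pattern m₃₁ = suc m₂₃
pattern m₃₂ = suc m₃₁
pattern m₃₃ = suc m₃₂

-- In the coordinates p and q with entries p (i - j) + q (i + j), indices mod 3, the
-- constraints of kind any compare the pₖ with each other, and likewise the qₖ. They
-- exclude nothing: sorting p and q first keeps the decomposition small.
magilatinConstraints : List (Constraint 10)
magilatinConstraints =
    (m₁₁ ∷ m₁₂ ∷ m₁₃ ∷ []) ⟨ equals ⟩ (m₁₃ ∷ m₂₃ ∷ m₃₃ ∷ [])
  ∷ (m₁₁ ∷ m₁₂ ∷ m₁₃ ∷ []) ⟨ equals ⟩ (m₃₁ ∷ m₃₂ ∷ m₃₃ ∷ [])
  ∷ (m₁₁ ∷ m₁₂ ∷ m₁₃ ∷ []) ⟨ equals ⟩ (m₁₂ ∷ m₂₂ ∷ m₃₂ ∷ [])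
  ∷ (m₁₁ ∷ m₁₂ ∷ m₁₃ ∷ []) ⟨ equals ⟩ (m₁₁ ∷ m₂₁ ∷ m₃₁ ∷ [])
  ∷ (m₁₁ ∷ m₁₂ ∷ m₁₃ ∷ []) ⟨ equals ⟩ (m₂₁ ∷ m₂₂ ∷ m₂₃ ∷ [])
  ∷ [ m₁₁ ] ⟨ any ⟩ [ m₃₂ ]
  ∷ [ m₁₁ ] ⟨ any ⟩ [ m₂₃ ]
  ∷ [ m₃₂ ] ⟨ any ⟩ [ m₂₃ ]
  ∷ [ m₁₁ ] ⟨ any ⟩ [ m₃₃ ]
  ∷ [ m₁₁ ] ⟨ any ⟩ [ m₂₂ ]
  ∷ [ m₃₃ ] ⟨ any ⟩ [ m₂₂ ]
  ∷ [ m₃₃ ] ⟨ less-than ⟩ [ bound ]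
  ∷ [ m₃₂ ] ⟨ less-than ⟩ [ bound ]
  ∷ [ m₃₁ ] ⟨ less-than ⟩ [ bound ]
  ∷ [ m₂₃ ] ⟨ less-than ⟩ [ bound ]
  ∷ [ m₂₂ ] ⟨ less-than ⟩ [ bound ]
  ∷ [ m₂₁ ] ⟨ less-than ⟩ [ bound ]
  ∷ [ m₁₃ ] ⟨ less-than ⟩ [ bound ]
  ∷ [ m₁₂ ] ⟨ less-than ⟩ [ bound ]
  ∷ [ m₁₁ ] ⟨ less-than ⟩ [ bound ]
  ∷ [ m₁₁ ] ⟨ distinct ⟩ [ m₁₂ ]
  ∷ [ m₁₁ ] ⟨ distinct ⟩ [ m₁₃ ]
  ∷ [ m₁₁ ] ⟨ distinct ⟩ [ m₂₁ ]
  ∷ [ m₁₁ ] ⟨ distinct ⟩ [ m₃₁ ]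
  ∷ [ m₁₂ ] ⟨ distinct ⟩ [ m₁₃ ]
  ∷ [ m₁₂ ] ⟨ distinct ⟩ [ m₂₂ ]
  ∷ [ m₁₂ ] ⟨ distinct ⟩ [ m₃₂ ]
  ∷ [ m₁₃ ] ⟨ distinct ⟩ [ m₂₃ ]
  ∷ [ m₁₃ ] ⟨ distinct ⟩ [ m₃₃ ]
  ∷ [ m₂₁ ] ⟨ distinct ⟩ [ m₂₂ ]
  ∷ [ m₂₁ ] ⟨ distinct ⟩ [ m₂₃ ]
  ∷ [ m₂₁ ] ⟨ distinct ⟩ [ m₃₁ ]
  ∷ [ m₂₂ ] ⟨ distinct ⟩ [ m₂₃ ]
  ∷ [ m₂₂ ] ⟨ distinct ⟩ [ m₃₂ ]
  ∷ [ m₂₃ ] ⟨ distinct ⟩ [ m₃₃ ]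
  ∷ [ m₃₁ ] ⟨ distinct ⟩ [ m₃₂ ]
  ∷ [ m₃₁ ] ⟨ distinct ⟩ [ m₃₃ ]
  ∷ [ m₃₂ ] ⟨ distinct ⟩ [ m₃₃ ]
  ∷ []

private
  module _ {a b : ℕ} where
    -- `total` of a single coordinate ends in `+ 0`; these four lemmas remove and restore it.
    lt : a ℕ.+ 0 ℕ.< b ℕ.+ 0 → a ℕ.< b
    lt = ℕ.+-cancelʳ-< 0 a b

    ne : a ℕ.+ 0 ≢ b ℕ.+ 0 → a ≢ b
    ne h refl = h refl

    lt⁻¹ : a ℕ.< b → a ℕ.+ 0 ℕ.< b ℕ.+ 0
    lt⁻¹ = ℕ.+-monoˡ-< 0

    ne⁻¹ : a ≢ b → a ℕ.+ 0 ≢ b ℕ.+ 0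
    ne⁻¹ h = h ∘ ℕ.+-cancelʳ-≡ 0 a b

open Elimination 10 bound using (Solution; solution)

-- The bound is itself an unknown of the system, so a solution yields a square together with a
-- bound; the weight then fixes the bound to be `t`.
Bounded : ℕ → Matrix × ℕ → Set
Bounded t (M , u) = u ≡ t × CubicalMagilatin t M

toSquare : Vec ℕ 10 → Matrix × ℕ
toSquare (u ∷ a ∷ b ∷ c ∷ d ∷ e ∷ f ∷ g ∷ h ∷ i ∷ []) =
  ((suc a ∷ suc b ∷ suc c ∷ []) ∷ (suc d ∷ suc e ∷ suc f ∷ []) ∷ (suc g ∷ suc h ∷ suc i ∷ []) ∷ []) , suc u

fromSquare : Matrix × ℕ → Vec ℕ 10
fromSquare (((a ∷ b ∷ c ∷ []) ∷ (d ∷ e ∷ f ∷ []) ∷ (g ∷ h ∷ i ∷ []) ∷ []) , u) =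
  Vec.map ℕ.pred (u ∷ a ∷ b ∷ c ∷ d ∷ e ∷ f ∷ g ∷ h ∷ i ∷ [])

module _ {cs : List (Constraint 10)} {u : ℕ} (xs : Vec ℕ 10) where
  solution⇒satisfies : Solution cs (units 10) u xs →
    All (Satisfies (Vec.map suc xs)) cs × lookup (Vec.map suc xs) bound ≡ u
  solution⇒satisfies (solution sol eq) =
      All.map (λ {c} → subst₂ (Related (kind c))
        (total-units (lhs c) xs) (total-units (rhs c) xs)) sol
    , trans (sym (lookup-units bound xs)) eq

  satisfies⇒solution : All (Satisfies (Vec.map suc xs)) cs → lookup (Vec.map suc xs) bound ≡ u →
    Solution cs (units 10) u xs
  satisfies⇒solution sat eq = solution
    (All.map (λ {c} → subst₂ (Related (kind c))
      (sym (total-units (lhs c) xs)) (sym (total-units (rhs c) xs))) sat)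
    (trans (lookup-units bound xs) eq)

solution⇒magilatin : ∀ {u} xs → Solution magilatinConstraints (units 10) u xs → Bounded u (toSquare xs)
solution⇒magilatin xs@(u ∷ a ∷ b ∷ c ∷ d ∷ e ∷ f ∷ g ∷ h ∷ i ∷ []) sol
  -- The order is that of `magilatinConstraints`: five sums compared with the first row, six
  -- comparisons without content, nine upper bounds, eighteen disequations.
  with ( col₃ ∷ row₃ ∷ col₂ ∷ col₁ ∷ row₂ ∷ _ ∷ _ ∷ _ ∷ _ ∷ _ ∷ _
       ∷ <i ∷ <h ∷ <g ∷ <f ∷ <e ∷ <d ∷ <c ∷ <b ∷ <a ∷ ab ∷ ac ∷ ad ∷ ag ∷ bc ∷ be ∷ bh ∷ cf ∷ ci
       ∷ de ∷ df ∷ dg ∷ ef ∷ eh ∷ fi ∷ gh ∷ gi ∷ hi ∷ []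
       ) , refl ← solution⇒satisfies xs sol
  = refl , magilatin
      ((z<s ∷ z<s ∷ z<s ∷ []) ∷ (z<s ∷ z<s ∷ z<s ∷ []) ∷ (z<s ∷ z<s ∷ z<s ∷ []) ∷ [])
      (λ i j → trans (sym (fromFirst i)) (fromFirst j))
      (((ne ab ∷ ne ac ∷ []) ∷ (ne bc ∷ []) ∷ [] ∷ [])
      ∷ ((ne de ∷ ne df ∷ []) ∷ (ne ef ∷ []) ∷ [] ∷ [])
      ∷ ((ne gh ∷ ne gi ∷ []) ∷ (ne hi ∷ []) ∷ [] ∷ []) ∷ [])
      (((ne ad ∷ ne ag ∷ []) ∷ (ne dg ∷ []) ∷ [] ∷ [])
      ∷ ((ne be ∷ ne bh ∷ []) ∷ (ne eh ∷ []) ∷ [] ∷ [])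
      ∷ ((ne cf ∷ ne ci ∷ []) ∷ (ne fi ∷ []) ∷ [] ∷ []) ∷ [])
    , (((z<s , lt <a) ∷ (z<s , lt <b) ∷ (z<s , lt <c) ∷ [])
      ∷ ((z<s , lt <d) ∷ (z<s , lt <e) ∷ (z<s , lt <f) ∷ [])
      ∷ ((z<s , lt <g) ∷ (z<s , lt <h) ∷ (z<s , lt <i) ∷ []) ∷ [])
  where
  v = lineSums (proj₁ (toSquare xs))
  fromFirst : ∀ i → lookup v zero ≡ lookup v i
  fromFirst zero = refl
  fromFirst (suc zero) = row₂
  fromFirst (suc (suc zero)) = row₃
  fromFirst (suc (suc (suc zero))) = col₁
  fromFirst (suc (suc (suc (suc zero)))) = col₂
  fromFirst (suc (suc (suc (suc (suc zero))))) = col₃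

magilatin⇒solution : ∀ {u} M → Bounded u M →
  Solution magilatinConstraints (units 10) u (fromSquare M) × toSquare (fromSquare M) ≡ M
magilatin⇒solution (((a ∷ b ∷ c ∷ []) ∷ (d ∷ e ∷ f ∷ []) ∷ (g ∷ h ∷ i ∷ []) ∷ []) , _)
  (refl , magilatin
      ((z<s ∷ z<s ∷ z<s ∷ []) ∷ (z<s ∷ z<s ∷ z<s ∷ []) ∷ (z<s ∷ z<s ∷ z<s ∷ []) ∷ [])
      eq
      (((ab ∷ ac ∷ []) ∷ (bc ∷ []) ∷ [] ∷ [])
      ∷ ((de ∷ df ∷ []) ∷ (ef ∷ []) ∷ [] ∷ [])
      ∷ ((gh ∷ gi ∷ []) ∷ (hi ∷ []) ∷ [] ∷ []) ∷ [])
      (((ad ∷ ag ∷ []) ∷ (dg ∷ []) ∷ [] ∷ [])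
      ∷ ((be ∷ bh ∷ []) ∷ (eh ∷ []) ∷ [] ∷ [])
      ∷ ((cf ∷ ci ∷ []) ∷ (fi ∷ []) ∷ [] ∷ []) ∷ [])
    -- Matching on one upper bound reveals the bound as a successor, so that `toSquare` restores it
    -- from its predecessor.
    , (((_ , <a@(s≤s _)) ∷ (_ , <b) ∷ (_ , <c) ∷ [])
      ∷ ((_ , <d) ∷ (_ , <e) ∷ (_ , <f) ∷ [])
      ∷ ((_ , <g) ∷ (_ , <h) ∷ (_ , <i) ∷ []) ∷ []))
  = satisfies⇒solution _
      ( eq zero (# 5) ∷ eq zero (# 2) ∷ eq zero (# 4) ∷ eq zero (# 3) ∷ eq zero (# 1) ∷ tt ∷ tt ∷ tt ∷ tt ∷ tt ∷ tt
       ∷ lt⁻¹ <i ∷ lt⁻¹ <h ∷ lt⁻¹ <g ∷ lt⁻¹ <f ∷ lt⁻¹ <e ∷ lt⁻¹ <d ∷ lt⁻¹ <c ∷ lt⁻¹ <b ∷ lt⁻¹ <a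
       ∷ ne⁻¹ ab ∷ ne⁻¹ ac ∷ ne⁻¹ ad ∷ ne⁻¹ ag ∷ ne⁻¹ bc ∷ ne⁻¹ be ∷ ne⁻¹ bh ∷ ne⁻¹ cf ∷ ne⁻¹ ci
       ∷ ne⁻¹ de ∷ ne⁻¹ df ∷ ne⁻¹ dg ∷ ne⁻¹ ef ∷ ne⁻¹ eh ∷ ne⁻¹ fi ∷ ne⁻¹ gh ∷ ne⁻¹ gi ∷ ne⁻¹ hi ∷ []
      ) refl , refl

-- The enumeration that defines `Lᶜ` and the one obtained from the system list the same pairs, hence
-- have the same length.
Counts-magilatin : ∀ {s} → Counts (Solution magilatinConstraints (units 10)) s → ∀ t → + Lᶜ t ≡ s t
Counts-magilatin c t =
  let (e , |e|≡) = Counts-map {G = Bounded} toSquare fromSquare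
                     (λ { (u ∷ a ∷ b ∷ c ∷ d ∷ e ∷ f ∷ g ∷ h ∷ i ∷ []) → refl })
                     (λ {_} {xs} → solution⇒magilatin xs) (λ {_} {M} → magilatin⇒solution M) c t
      (e′ , |e′|≡) = map-enumeration {Q = Bounded t} (_, t) proj₁ (λ _ → refl) (refl ,_)
                       (λ { (refl , M) → M , refl }) (cubicalMagilatins t)
  in trans (cong +_ (trans (sym |e′|≡) (cardinality-unique e′ e))) |e|≡

-- The generating function

∏𝟙⊖X-++ : ∀ js ks → ∏𝟙⊖X (js ++ ks) ≈ ∏𝟙⊖X js ⊛ ∏𝟙⊖X ks
∏𝟙⊖X-++ []       ks = ≈-sym (⊛-identityˡ (∏𝟙⊖X ks))
∏𝟙⊖X-++ (j ∷ js) ks = ≈-trans (⊛-congˡ (𝟙 ⊖ X^ j) (∏𝟙⊖X-++ js ks))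
  (≈-sym (⊛-assoc (𝟙 ⊖ X^ j) (∏𝟙⊖X js) (∏𝟙⊖X ks)))

12X⁴B : Poly
12X⁴B = List.map (+ 12 ℤ.*_) (shift 4 (applyUpTo B 16))

-- A common denominator of the cones that occur, split off the stated one.
extraFactors statedFactors factors : List ℕ
extraFactors  = 1 ∷ 1 ∷ 1 ∷ 1 ∷ 4 ∷ 5 ∷ 6 ∷ 7 ∷ []
statedFactors = 2 ∷ 2 ∷ 3 ∷ 3 ∷ 4 ∷ 5 ∷ []
factors       = extraFactors ++ statedFactors

-- The whole decomposition is carried out by evaluation. The fuel 1000 bounds the depth of the
-- recursion, not the number of cones.
numeratorSum : Elimination.eliminate 10 bound factors 1000 magilatinConstraints (units 10)
  ≡ just (times∏ extraFactors 12X⁴B)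
numeratorSum = toWitness {a? = Maybe.≡-dec (List.≡-dec ℤ._≟_) _ _} _

⊛-solve⁻¹ : ∀ h {f g} ((h⁻¹ , _) : Invertible h) → f ≈ h⁻¹ ⊛ g → h ⊛ f ≈ g
⊛-solve⁻¹ h {f} {g} (h⁻¹ , inv) f≈h⁻¹g = begin
  h ⊛ f            ≈⟨ ⊛-congˡ h f≈h⁻¹g ⟩
  h ⊛ (h⁻¹ ⊛ g)    ≈⟨ ⊛-assoc h h⁻¹ g ⟨
  (h ⊛ h⁻¹) ⊛ g    ≈⟨ ⊛-congʳ g inv ⟩
  𝟙 ⊛ g            ≈⟨ ⊛-identityˡ g ⟩
  g                ∎
  where open ≈-Reasoning

-- Degree 0 is left out of the series by definition; this is harmless, as no entry is below 0 and
-- `Lᶜ 0` evaluates to 0.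
generatingFunction-Lᶜ : ∀ n → generatingFunction Lᶜ n ≡ + Lᶜ n
generatingFunction-Lᶜ zero    = refl
generatingFunction-Lᶜ (suc n) = refl

stated-nonZero : All NonZero statedFactors
stated-nonZero = _ ∷ _ ∷ _ ∷ _ ∷ _ ∷ _ ∷ []

extra-nonZero : All NonZero extraFactors
extra-nonZero = _ ∷ _ ∷ _ ∷ _ ∷ _ ∷ _ ∷ _ ∷ _ ∷ []

-- Both sides of the computed identity carry the extra factors, which cancel because `1 - x^k` with
-- positive `k` is a unit among power series.
denominator-Lᶜ : ∏𝟙⊖X statedFactors ⊛ generatingFunction Lᶜ ≈ ⟦ 12X⁴B ⟧
denominator-Lᶜ = ⊛-cancelˡ (∏𝟙⊖X extraFactors) (∏𝟙⊖X-invertible extra-nonZero) (begin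
  ∏𝟙⊖X extraFactors ⊛ (∏𝟙⊖X statedFactors ⊛ generatingFunction Lᶜ)
    ≈⟨ ⊛-assoc (∏𝟙⊖X extraFactors) (∏𝟙⊖X statedFactors) (generatingFunction Lᶜ) ⟨
  (∏𝟙⊖X extraFactors ⊛ ∏𝟙⊖X statedFactors) ⊛ generatingFunction Lᶜ
    ≈⟨ ⊛-congʳ (generatingFunction Lᶜ) (∏𝟙⊖X-++ extraFactors statedFactors) ⟨
  ∏𝟙⊖X factors ⊛ generatingFunction Lᶜ
    ≈⟨ ⊛-solve⁻¹ (∏𝟙⊖X factors) (∏𝟙⊖X-invertible nonZero)
         (λ t → trans (generatingFunction-Lᶜ t)
           (Counts-magilatin
             (Elimination.eliminate-sound 10 bound factors nonZero 1000 magilatinConstraints (units 10) numeratorSum)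
             t)) ⟩
  ⟦ times∏ extraFactors 12X⁴B ⟧
    ≈⟨ ⟦times∏⟧ extraFactors 12X⁴B ⟩
  ∏𝟙⊖X extraFactors ⊛ ⟦ 12X⁴B ⟧ ∎)
  where
  open ≈-Reasoning
  nonZero : All NonZero factors
  nonZero = _ ∷ _ ∷ _ ∷ _ ∷ _ ∷ _ ∷ _ ∷ _ ∷ stated-nonZero

denominator : Series
denominator = (𝟙 ⊖ X^ 2) ^ 2 ⊛ (𝟙 ⊖ X^ 3) ^ 2 ⊛ (𝟙 ⊖ X^ 4) ⊛ (𝟙 ⊖ X^ 5)

denominator-∏𝟙⊖X : denominator ≈ ∏𝟙⊖X statedFactors
denominator-∏𝟙⊖X = solve 4 (λ a b c d →
    -- A square `f ^ 2` unfolds to `f ⊛ (f ⊛ 𝟙)`, whence the units.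
    (a ⊕ᵉ (a ⊕ᵉ one)) ⊕ᵉ (b ⊕ᵉ (b ⊕ᵉ one)) ⊕ᵉ c ⊕ᵉ d ⊜ a ⊕ᵉ (a ⊕ᵉ (b ⊕ᵉ (b ⊕ᵉ (c ⊕ᵉ (d ⊕ᵉ one)))))) ≈-refl
    (𝟙 ⊖ X^ 2) (𝟙 ⊖ X^ 3) (𝟙 ⊖ X^ 4) (𝟙 ⊖ X^ 5)
  where
  open CommutativeMonoidSolver ⊛-commutativeMonoid
    renaming (_⊕_ to infixl 7 _⊕ᵉ_; id to one)

·-⊛ : ∀ a f g → a · f ⊛ g ≈ a · (f ⊛ g)
·-⊛ a = ⊛-scale (+ a)

⊛-· : ∀ a f g → f ⊛ a · g ≈ a · (f ⊛ g)
⊛-· a f g n = begin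
  (f ⊛ a · g) n        ≡⟨ ⊛-comm f (a · g) n ⟩
  (a · g ⊛ f) n        ≡⟨ ·-⊛ a g f n ⟩
  + a ℤ.* (g ⊛ f) n    ≡⟨ cong (+ a ℤ.*_) (⊛-comm g f n) ⟩
  + a ℤ.* (f ⊛ g) n    ∎
  where open ≡-Reasoning

⟦map-*⟧ : ∀ a p → ⟦ List.map (+ a ℤ.*_) p ⟧ ≈ a · ⟦ p ⟧
⟦map-*⟧ a []      n       = sym (ℤ.*-zeroʳ (+ a))
⟦map-*⟧ a (b ∷ p) zero    = refl
⟦map-*⟧ a (b ∷ p) (suc n) = ⟦map-*⟧ a p n

⟦applyUpTo⟧ : ∀ f m → (∀ n → f (m ℕ.+ n) ≡ 0ℤ) → ⟦ applyUpTo f m ⟧ ≈ f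
⟦applyUpTo⟧ f zero    vanishes n       = sym (vanishes n)
⟦applyUpTo⟧ f (suc m) vanishes zero    = refl
⟦applyUpTo⟧ f (suc m) vanishes (suc n) = ⟦applyUpTo⟧ (tail f) m vanishes n

⟦12X⁴B⟧ : ⟦ 12X⁴B ⟧ ≈ 12 · X^ 4 ⊛ B
⟦12X⁴B⟧ = begin
  ⟦ 12X⁴B ⟧                           ≈⟨ ⟦map-*⟧ 12 (shift 4 (applyUpTo B 16)) ⟩
  12 · ⟦ shift 4 (applyUpTo B 16) ⟧   ≈⟨ ·-cong (⟦shift⟧ 4 (applyUpTo B 16)) ⟩
  -- `B` has degree 15, so its coefficients from degree 16 on evaluate to 0.
  12 · (X^ 4 ⊛ ⟦ applyUpTo B 16 ⟧)    ≈⟨ ·-cong (⊛-congˡ (X^ 4) (⟦applyUpTo⟧ B 16 λ _ → refl)) ⟩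
  12 · (X^ 4 ⊛ B)                     ≈⟨ ·-⊛ 12 (X^ 4) B ⟨
  12 · X^ 4 ⊛ B                       ∎
  where
  open ≈-Reasoning
  ·-cong : ∀ {f g} → f ≈ g → 12 · f ≈ 12 · g
  ·-cong f≈g n = cong (+ 12 ℤ.*_) (f≈g n)

generatingFunction-Lᶜ-÷ : generatingFunction Lᶜ ≈ 12 · X^ 4 ⊛ B ÷ denominator
generatingFunction-Lᶜ-÷ =
  let (h⁻¹ , inv) = ∏𝟙⊖X-invertible stated-nonZero in
    h⁻¹
  , ≈-trans (⊛-congʳ h⁻¹ denominator-∏𝟙⊖X) inv
  , (begin
    generatingFunction Lᶜ    ≈⟨ ⊛-solve (∏𝟙⊖X statedFactors) (h⁻¹ , inv) denominator-Lᶜ ⟩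
    h⁻¹ ⊛ ⟦ 12X⁴B ⟧          ≈⟨ ⊛-congˡ h⁻¹ ⟦12X⁴B⟧ ⟩
    h⁻¹ ⊛ (12 · X^ 4 ⊛ B)    ≈⟨ ⊛-comm h⁻¹ (12 · X^ 4 ⊛ B) ⟩
    12 · X^ 4 ⊛ B ⊛ h⁻¹      ∎)
  where open ≈-Reasoning

-- The quasipolynomial

-- 120 is a common denominator of all coefficients; after scaling by it, the finite checks run on
-- integers.
120c₀-table : Vec (Vec ℤ 5) 12
120c₀-table =
    (+ 113760 ∷ + 113760 ∷ + 117216 ∷ + 106848 ∷ + 117216 ∷ [])
  ∷ (+ 76933 ∷ + 87301 ∷ + 83845 ∷ + 83845 ∷ + 87301 ∷ [])
  ∷ (+ 111200 ∷ + 114656 ∷ + 104288 ∷ + 114656 ∷ + 111200 ∷ [])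
  ∷ (+ 106821 ∷ + 103365 ∷ + 103365 ∷ + 106821 ∷ + 96453 ∷ [])
  ∷ (+ 106336 ∷ + 95968 ∷ + 106336 ∷ + 102880 ∷ + 102880 ∷ [])
  ∷ (+ 92165 ∷ + 92165 ∷ + 95621 ∷ + 85253 ∷ + 95621 ∷ [])
  ∷ (+ 106848 ∷ + 117216 ∷ + 113760 ∷ + 113760 ∷ + 117216 ∷ [])
  ∷ (+ 92485 ∷ + 95941 ∷ + 85573 ∷ + 95941 ∷ + 92485 ∷ [])
  ∷ (+ 114656 ∷ + 111200 ∷ + 111200 ∷ + 114656 ∷ + 104288 ∷ [])
  ∷ (+ 98181 ∷ + 87813 ∷ + 98181 ∷ + 94725 ∷ + 94725 ∷ [])
  ∷ (+ 102880 ∷ + 102880 ∷ + 106336 ∷ + 95968 ∷ + 106336 ∷ [])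
  ∷ (+ 93893 ∷ + 104261 ∷ + 100805 ∷ + 100805 ∷ + 104261 ∷ [])
  ∷ []

120c₁-values : Vec ℤ 6
120c₁-values = + 119280 ∷ + 114540 ∷ + 119280 ∷ + 115500 ∷ + 118320 ∷ + 115500 ∷ []

120c₂-values : Vec ℤ 2
120c₂-values = + 45228 ∷ + 44958 ∷ []

120c₀ 120c₁ 120c₂ : ℕ → ℤ
120c₀ t = lookup (lookup 120c₀-table (t mod 12)) ((t ℕ./ 12) mod 5)
120c₁ t = lookup 120c₁-values (t mod 6)
120c₂ t = lookup 120c₂-values (t mod 2)

-- Adding 60 adds 5 to `t / 12`; that the remainders modulo 12 and 5 stay the same holds by
-- computation.
120c₀-periodic : ∀ t → 120c₀ (60 ℕ.+ t) ≡ 120c₀ t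
120c₀-periodic t = cong (λ q → lookup (lookup 120c₀-table (t mod 12)) (q mod 5))
  (+-distrib-/-∣ˡ {60} t {12} (divides 5 refl))

quintic : ℤ → ℤ → ℤ → ℤ → ℤ
quintic a₂ a₁ a₀ x =
  ((((+ 36 ℤ.* x ℤ.- + 765) ℤ.* x ℤ.+ + 8080) ℤ.* x ℤ.- a₂) ℤ.* x ℤ.+ a₁) ℤ.* x ℤ.- a₀

quasi : ℕ → ℤ
quasi t = quintic (120c₂ t) (120c₁ t) (120c₀ t) (+ t)

-- Finite differences and products with `(1 - x^p)^j`

iterate : ∀ {A : Set} → ℕ → (A → A) → A → A
iterate zero    f x = x
iterate (suc j) f x = f (iterate j f x)

Δ : ℕ → (ℕ → ℤ) → ℕ → ℤ
Δ p f t = f (p ℕ.+ t) ℤ.- f t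

Δℤ : (ℤ → ℤ) → ℤ → ℤ
Δℤ f x = f (+ 60 ℤ.+ x) ℤ.- f x

-- The coefficients have period 60, so differences with step 60 treat them as constants and act on
-- the polynomial alone.
Δ-quasi : ∀ j t → iterate j (Δ 60) quasi t ≡ iterate j Δℤ (quintic (120c₂ t) (120c₁ t) (120c₀ t)) (+ t)
Δ-quasi zero    t = refl
Δ-quasi (suc j) t = cong₂ ℤ._-_
  (trans (Δ-quasi j (60 ℕ.+ t))
    (cong (λ c → iterate j Δℤ (quintic (120c₂ t) (120c₁ t) c) (+ 60 ℤ.+ + t)) (120c₀-periodic t)))
  (Δ-quasi j t)

-- Each difference lowers the degree by one, so six of them annihilate a quintic.
Δℤ-quintic : ∀ a₂ a₁ a₀ x → iterate 6 Δℤ (quintic a₂ a₁ a₀) x ≡ 0ℤ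
Δℤ-quintic = solve 4 (λ a₂ a₁ a₀ x →
    iterate 6 (λ f x → f (con (+ 60) :+ x) :- f x)
      (λ x → ((((con (+ 36) :* x :- con (+ 765)) :* x :+ con (+ 8080)) :* x :- a₂) :* x :+ a₁) :* x :- a₀) x
    := con 0ℤ) refl
  where open ℤSolver.+-*-Solver

Δ-cong : ∀ p {f g} → (∀ {t} → 1 ≤ t → f t ≡ g t) →
  ∀ j {t} → 1 ≤ t → iterate j (Δ p) f t ≡ iterate j (Δ p) g t
Δ-cong p f≡g zero    1≤t = f≡g 1≤t
Δ-cong p f≡g (suc j) 1≤t = cong₂ ℤ._-_ (Δ-cong p f≡g j (ℕ.m≤n⇒m≤o+n p 1≤t)) (Δ-cong p f≡g j 1≤t)

-- From degree `j * p` on, all terms of `(1 - x^p)^j f` are present, and its coefficients are the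
-- `j`-th differences of `f` with step `p`.
∏𝟙⊖X-replicate-above : ∀ p j f t →
  (∏𝟙⊖X (List.replicate j p) ⊛ f) (j ℕ.* p ℕ.+ t) ≡ iterate j (Δ p) f t
∏𝟙⊖X-replicate-above p zero    f t = ⊛-identityˡ f t
∏𝟙⊖X-replicate-above p (suc j) f t = begin
  (((𝟙 ⊖ X^ p) ⊛ ∏p) ⊛ f) (p ℕ.+ j ℕ.* p ℕ.+ t)
    ≡⟨ cong (((𝟙 ⊖ X^ p) ⊛ ∏p) ⊛ f) (ℕ.+-assoc p (j ℕ.* p) t) ⟩
  (((𝟙 ⊖ X^ p) ⊛ ∏p) ⊛ f) (p ℕ.+ (j ℕ.* p ℕ.+ t))
    ≡⟨ ⊛-assoc (𝟙 ⊖ X^ p) ∏p f (p ℕ.+ (j ℕ.* p ℕ.+ t)) ⟩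
  ((𝟙 ⊖ X^ p) ⊛ (∏p ⊛ f)) (p ℕ.+ (j ℕ.* p ℕ.+ t))
    ≡⟨ 𝟙⊖X-above p (∏p ⊛ f) (j ℕ.* p ℕ.+ t) ⟩
  (∏p ⊛ f) (p ℕ.+ (j ℕ.* p ℕ.+ t)) ℤ.- (∏p ⊛ f) (j ℕ.* p ℕ.+ t)
    ≡⟨ cong (λ n → (∏p ⊛ f) n ℤ.- (∏p ⊛ f) (j ℕ.* p ℕ.+ t)) (swap p (j ℕ.* p) t) ⟩
  (∏p ⊛ f) (j ℕ.* p ℕ.+ (p ℕ.+ t)) ℤ.- (∏p ⊛ f) (j ℕ.* p ℕ.+ t)
    ≡⟨ cong₂ ℤ._-_ (∏𝟙⊖X-replicate-above p j f (p ℕ.+ t)) (∏𝟙⊖X-replicate-above p j f t) ⟩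
  iterate (suc j) (Δ p) f t ∎
  where
  open ≡-Reasoning
  ∏p = ∏𝟙⊖X (List.replicate j p)
  swap : ∀ a b c → a ℕ.+ (b ℕ.+ c) ≡ b ℕ.+ (a ℕ.+ c)
  swap = solve-∀-ℕ

-- Coefficients of a product below degree `m` involve only coefficients below `m`, so a series may
-- be truncated to a polynomial before multiplying.
∏𝟙⊖X-local : ∀ {f g m} → (∀ {n} → n ℕ.< m → f n ≡ g n) →
  ∀ ks {n} → n ℕ.< m → (∏𝟙⊖X ks ⊛ f) n ≡ (∏𝟙⊖X ks ⊛ g) n
∏𝟙⊖X-local {f} {g} {m} f≡g []       {n} n<m = trans (⊛-identityˡ f n) (trans (f≡g n<m) (sym (⊛-identityˡ g n)))
∏𝟙⊖X-local {f} {g} {m} f≡g (k ∷ ks) {n} n<m = begin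
  (((𝟙 ⊖ X^ k) ⊛ p) ⊛ f) n    ≡⟨ ⊛-assoc (𝟙 ⊖ X^ k) p f n ⟩
  ((𝟙 ⊖ X^ k) ⊛ (p ⊛ f)) n    ≡⟨ local (position k n) n<m ⟩
  ((𝟙 ⊖ X^ k) ⊛ (p ⊛ g)) n    ≡⟨ ⊛-assoc (𝟙 ⊖ X^ k) p g n ⟨
  (((𝟙 ⊖ X^ k) ⊛ p) ⊛ g) n    ∎
  where
  open ≡-Reasoning
  p = ∏𝟙⊖X ks
  local : ∀ {n} → Position k n → n ℕ.< m → ((𝟙 ⊖ X^ k) ⊛ (p ⊛ f)) n ≡ ((𝟙 ⊖ X^ k) ⊛ (p ⊛ g)) n
  local (below n<k) n<m = trans (𝟙⊖X-below k (p ⊛ f) n<k)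
    (trans (∏𝟙⊖X-local f≡g ks n<m) (sym (𝟙⊖X-below k (p ⊛ g) n<k)))
  local (above n) k+n<m = trans (𝟙⊖X-above k (p ⊛ f) n)
    (trans (cong₂ ℤ._-_ (∏𝟙⊖X-local f≡g ks k+n<m) (∏𝟙⊖X-local f≡g ks (ℕ.≤-<-trans (ℕ.m≤n+m n k) k+n<m)))
      (sym (𝟙⊖X-above k (p ⊛ g) n)))

⟦applyUpTo⟧-below : ∀ f {m n} → n ℕ.< m → ⟦ applyUpTo f m ⟧ n ≡ f n
⟦applyUpTo⟧-below f {suc m} {zero}  _         = refl
⟦applyUpTo⟧-below f {suc m} {suc n} (s≤s n<m) = ⟦applyUpTo⟧-below (tail f) n<m

⟦take⟧-below : ∀ p {m n} → n ℕ.< m → ⟦ List.take m p ⟧ n ≡ ⟦ p ⟧ n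
⟦take⟧-below []      {suc m} {n}     _         = refl
⟦take⟧-below (a ∷ p) {suc m} {zero}  _         = refl
⟦take⟧-below (a ∷ p) {suc m} {suc n} (s≤s n<m) = ⟦take⟧-below p n<m

⟦take⟧-above : ∀ m p n → ⟦ List.take m p ⟧ (m ℕ.+ n) ≡ 0ℤ
⟦take⟧-above zero    p       n = refl
⟦take⟧-above (suc m) []      n = refl
⟦take⟧-above (suc m) (a ∷ p) n = ⟦take⟧-above m p n

-- `quasi 0` is not 0 but the negative of `120c₀ 0`, whereas the generating function starts in
-- degree 1.
quasiSeries : Series
quasiSeries zero    = 0ℤ
quasiSeries (suc n) = quasi (suc n)

quasiSeries-quasi : ∀ {t} → 1 ≤ t → quasiSeries t ≡ quasi t
quasiSeries-quasi {suc t} _ = refl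

Δ-quasi-vanishes : ∀ j → (∀ a₂ a₁ a₀ x → iterate j Δℤ (quintic a₂ a₁ a₀) x ≡ 0ℤ) →
  ∀ {t} → 1 ≤ t → iterate j (Δ 60) quasiSeries t ≡ 0ℤ
Δ-quasi-vanishes j vanishes {t} 1≤t = begin
  iterate j (Δ 60) quasiSeries t                                     ≡⟨ Δ-cong 60 quasiSeries-quasi j 1≤t ⟩
  iterate j (Δ 60) quasi t                                           ≡⟨ Δ-quasi j t ⟩
  iterate j Δℤ (quintic (120c₂ t) (120c₁ t) (120c₀ t)) (+ t)         ≡⟨ vanishes (120c₂ t) (120c₁ t) (120c₀ t) (+ t) ⟩
  0ℤ                                                                 ∎
  where open ≡-Reasoning

-- Beyond degree `j * p` the coefficients are differences at some `t ≥ 1` and vanish. Degree `j * p`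
-- itself belongs to `t = 0`, where nothing is assumed; hence the `suc`.
∏𝟙⊖X-vanishes : ∀ p j f → (∀ {t} → 1 ≤ t → iterate j (Δ p) f t ≡ 0ℤ) →
  ∏𝟙⊖X (List.replicate j p) ⊛ f ≈
    ⟦ List.take (suc (j ℕ.* p)) (times∏ (List.replicate j p) (applyUpTo f (suc (j ℕ.* p)))) ⟧
∏𝟙⊖X-vanishes p j f vanishes n with position (suc (j ℕ.* p)) n
... | below n<m = begin
  (∏𝟙⊖X ps ⊛ f) n                     ≡⟨ ∏𝟙⊖X-local (λ lt → sym (⟦applyUpTo⟧-below f lt)) ps n<m ⟩
  (∏𝟙⊖X ps ⊛ ⟦ applyUpTo f m ⟧) n     ≡⟨ ⟦times∏⟧ ps (applyUpTo f m) n ⟨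
  ⟦ times∏ ps (applyUpTo f m) ⟧ n     ≡⟨ ⟦take⟧-below (times∏ ps (applyUpTo f m)) n<m ⟨
  ⟦ List.take m (times∏ ps (applyUpTo f m)) ⟧ n ∎
  where
  open ≡-Reasoning
  m = suc (j ℕ.* p)
  ps = List.replicate j p
... | above n′ = begin
  (∏𝟙⊖X ps ⊛ f) (suc (j ℕ.* p ℕ.+ n′))    ≡⟨ cong (∏𝟙⊖X ps ⊛ f) (ℕ.+-suc (j ℕ.* p) n′) ⟨
  (∏𝟙⊖X ps ⊛ f) (j ℕ.* p ℕ.+ suc n′)      ≡⟨ ∏𝟙⊖X-replicate-above p j f (suc n′) ⟩
  iterate j (Δ p) f (suc n′)              ≡⟨ vanishes (s≤s ℕ.z≤n) ⟩
  0ℤ                                      ≡⟨ ⟦take⟧-above (suc (j ℕ.* p)) (times∏ ps (applyUpTo f (suc (j ℕ.* p)))) n′ ⟨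
  ⟦ List.take (suc (j ℕ.* p)) (times∏ ps (applyUpTo f (suc (j ℕ.* p)))) ⟧ (suc (j ℕ.* p ℕ.+ n′)) ∎
  where
  open ≡-Reasoning
  ps = List.replicate j p

sixties : List ℕ
sixties = List.replicate 6 60

quasiNumerator : Poly
quasiNumerator = List.take 361 (times∏ sixties (applyUpTo quasiSeries 361))

∏𝟙⊖X-quasiSeries : ∏𝟙⊖X sixties ⊛ quasiSeries ≈ ⟦ quasiNumerator ⟧
∏𝟙⊖X-quasiSeries = ∏𝟙⊖X-vanishes 60 6 quasiSeries (Δ-quasi-vanishes 6 Δℤ-quintic)

-- Two fractions compared by cross-multiplication: `quasiNumerator` over `(1 - x^60)^6`, and 120
-- times the stated fraction. Both sides are explicit lists, equal by evaluation.
numerators-agree :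
  times∏ statedFactors quasiNumerator ≡ times∏ sixties (List.map (+ 120 ℤ.*_) 12X⁴B)
numerators-agree = toWitness {a? = List.≡-dec ℤ._≟_ _ _} _

quasiSeries-120Lᶜ : quasiSeries ≈ 120 · generatingFunction Lᶜ
quasiSeries-120Lᶜ = ⊛-cancelˡ p (∏𝟙⊖X-invertible sixties-nonZero) (⊛-cancelˡ q (∏𝟙⊖X-invertible stated-nonZero) (begin
  q ⊛ (p ⊛ quasiSeries)                                  ≈⟨ ⊛-congˡ q ∏𝟙⊖X-quasiSeries ⟩
  q ⊛ ⟦ quasiNumerator ⟧                                 ≈⟨ ⟦times∏⟧ statedFactors quasiNumerator ⟨
  ⟦ times∏ statedFactors quasiNumerator ⟧                ≡⟨ cong ⟦_⟧ numerators-agree ⟩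
  ⟦ times∏ sixties (List.map (+ 120 ℤ.*_) 12X⁴B) ⟧       ≈⟨ ⟦times∏⟧ sixties (List.map (+ 120 ℤ.*_) 12X⁴B) ⟩
  p ⊛ ⟦ List.map (+ 120 ℤ.*_) 12X⁴B ⟧                    ≈⟨ ⊛-congˡ p (⟦map-*⟧ 120 12X⁴B) ⟩
  p ⊛ 120 · ⟦ 12X⁴B ⟧                                    ≈⟨ ⊛-congˡ p (λ n → cong (+ 120 ℤ.*_) (denominator-Lᶜ n)) ⟨
  p ⊛ 120 · (q ⊛ generatingFunction Lᶜ)                  ≈⟨ ⊛-congˡ p (⊛-· 120 q (generatingFunction Lᶜ)) ⟨
  p ⊛ (q ⊛ 120 · generatingFunction Lᶜ)                  ≈⟨ ⊛-swap p q (120 · generatingFunction Lᶜ) ⟩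
  q ⊛ (p ⊛ 120 · generatingFunction Lᶜ)                  ∎))
  where
  open ≈-Reasoning
  p = ∏𝟙⊖X sixties
  q = ∏𝟙⊖X statedFactors
  sixties-nonZero : All NonZero sixties
  sixties-nonZero = _ ∷ _ ∷ _ ∷ _ ∷ _ ∷ _ ∷ []

120Lᶜ : ∀ {t} → 1 ≤ t → quasi t ≡ + (120 ℕ.* Lᶜ t)
120Lᶜ {suc t} _ = trans (quasiSeries-120Lᶜ (suc t)) (sym (ℤ.pos-* 120 (Lᶜ (suc t))))

-- From integers to rational coefficients

ι : ℤ → ℚ
ι a = a ℚ./ 1

toℚᵘ-ι : ∀ a → ℚ.toℚᵘ (ι a) ℚᵘ.≃ mkℚᵘ a 0
toℚᵘ-ι a = ℚ.toℚᵘ-fromℚᵘ (mkℚᵘ a 0)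

ι-injective : Injective _≡_ _≡_ ι
ι-injective {a} {b} eq with *≡* a1≡b1 ← ℚ.fromℚᵘ-injective {mkℚᵘ a 0} {mkℚᵘ b 0} eq =
  trans (sym (ℤ.*-identityʳ a)) (trans a1≡b1 (ℤ.*-identityʳ b))

ι-* : ∀ a b → ι (a ℤ.* b) ≡ ι a ℚ.* ι b
ι-* a b = ℚ.toℚᵘ-injective (begin
  ℚ.toℚᵘ (ι (a ℤ.* b))                   ≈⟨ toℚᵘ-ι (a ℤ.* b) ⟩
  mkℚᵘ a 0 ℚᵘ.* mkℚᵘ b 0                 ≈⟨ ℚᵘ.*-cong (toℚᵘ-ι a) (toℚᵘ-ι b) ⟨
  ℚ.toℚᵘ (ι a) ℚᵘ.* ℚ.toℚᵘ (ι b)         ≈⟨ ℚ.toℚᵘ-homo-* (ι a) (ι b) ⟨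
  ℚ.toℚᵘ (ι a ℚ.* ι b)                   ∎)
  where open ℚᵘ.≃-Reasoning

ι-+ : ∀ a b → ι (a ℤ.+ b) ≡ ι a ℚ.+ ι b
ι-+ a b = ℚ.toℚᵘ-injective (begin
  ℚ.toℚᵘ (ι (a ℤ.+ b))                   ≈⟨ toℚᵘ-ι (a ℤ.+ b) ⟩
  mkℚᵘ (a ℤ.+ b) 0                       ≡⟨ cong₂ (λ a b → mkℚᵘ (a ℤ.+ b) 0) (ℤ.*-identityʳ a) (ℤ.*-identityʳ b) ⟨
  mkℚᵘ a 0 ℚᵘ.+ mkℚᵘ b 0                 ≈⟨ ℚᵘ.+-cong (toℚᵘ-ι a) (toℚᵘ-ι b) ⟨
  ℚ.toℚᵘ (ι a) ℚᵘ.+ ℚ.toℚᵘ (ι b)         ≈⟨ ℚ.toℚᵘ-homo-+ (ι a) (ι b) ⟨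
  ℚ.toℚᵘ (ι a ℚ.+ ι b)                   ∎)
  where open ℚᵘ.≃-Reasoning

ι-neg : ∀ a → ι (ℤ.- a) ≡ ℚ.- ι a
ι-neg a = ℚ.toℚᵘ-injective (begin
  ℚ.toℚᵘ (ι (ℤ.- a))       ≈⟨ toℚᵘ-ι (ℤ.- a) ⟩
  ℚᵘ.- mkℚᵘ a 0            ≈⟨ ℚᵘ.-‿cong (toℚᵘ-ι a) ⟨
  ℚᵘ.- ℚ.toℚᵘ (ι a)        ≈⟨ ℚ.toℚᵘ-homo‿- (ι a) ⟨
  ℚ.toℚᵘ (ℚ.- ι a)         ∎)
  where open ℚᵘ.≃-Reasoning

fromℕ-* : ∀ m n → fromℕ (m ℕ.* n) ≡ fromℕ m ℚ.* fromℕ n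
fromℕ-* m n = trans (cong ι (ℤ.pos-* m n)) (ι-* (+ m) (+ n))

fromℕ-injective : Injective _≡_ _≡_ fromℕ
fromℕ-injective eq = ℤ.+-injective (ι-injective eq)

1/120 : ℚ
1/120 = + 1 ℚ./ 120

c₂-values : Vec ℚ 2
c₂-values = + 3769 ℚ./ 10 ∷ + 7493 ℚ./ 20 ∷ []

c₂ : ℕ → ℚ
c₂ t = lookup c₂-values (t mod 2)

-- Dividing the integer table by 120 evaluates to the table of reduced fractions, so `lookup-map`
-- applies. The same holds for `c₁` and `c₀`.
c₂-120 : ∀ t → c₂ t ≡ ι (120c₂ t) ℚ.* 1/120
c₂-120 t = lookup-map (t mod 2) (λ a → ι a ℚ.* 1/120) 120c₂-values

c₁-120 : ∀ t → c₁ t ≡ ι (120c₁ t) ℚ.* 1/120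
c₁-120 t = lookup-map (t mod 6) (λ a → ι a ℚ.* 1/120) 120c₁-values

c₀-120 : ∀ t → c₀ t ≡ ι (120c₀ t) ℚ.* 1/120
c₀-120 t = trans
  (cong (λ row → lookup row ((t ℕ./ 12) mod 5)) (lookup-map (t mod 12) (Vec.map (λ a → ι a ℚ.* 1/120)) 120c₀-table))
  (lookup-map ((t ℕ./ 12) mod 5) (λ a → ι a ℚ.* 1/120) (lookup 120c₀-table (t mod 12)))

quinticPolynomial : ℚ → ℚ → ℚ → Polynomial
quinticPolynomial a₂ a₁ a₀ =
  ℚ.- a₀ ∷ a₁ ∷ ℚ.- a₂ ∷ + 202 ℚ./ 3 ∷ ℚ.- (+ 51 ℚ./ 8) ∷ + 3 ℚ./ 10 ∷ []

open CommutativeRing ℚ.+-*-commutativeRing using () renaming (commutativeSemiring to ℚ-commutativeSemiring)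

module _ {c ℓ} (R : CommutativeSemiring c ℓ) where
  open CommutativeSemiring R using (_+_; _*_; 0#) renaming (_≈_ to _∼_; refl to ∼-refl)
  open NaturalCoefficients R using (solve; con; _:+_; _:*_; _:=_)

  -- The left side has the shape of `eval`, which ends in `x * 0#`. Signs are absorbed into the
  -- coefficients, leaving an identity of semirings.
  horner-scale : ∀ a₅ a₄ a₃ a₂ a₁ a₀ r x →
    a₀ * r + x * (a₁ * r + x * (a₂ * r + x * (a₃ * r + x * (a₄ * r + x * (a₅ * r + x * 0#)))))
      ∼ (((((a₅ * x + a₄) * x + a₃) * x + a₂) * x + a₁) * x + a₀) * r
  horner-scale = solve 8 (λ a₅ a₄ a₃ a₂ a₁ a₀ r x →
    a₀ :* r :+ x :* (a₁ :* r :+ x :* (a₂ :* r :+ x :* (a₃ :* r :+ x :* (a₄ :* r :+ x :* (a₅ :* r :+ x :* con 0)))))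
      := (((((a₅ :* x :+ a₄) :* x :+ a₃) :* x :+ a₂) :* x :+ a₁) :* x :+ a₀) :* r) ∼-refl

  horner-expand : ∀ a₅ a₄ a₃ a₂ a₁ a₀ x →
    a₀ + x * (a₁ + x * (a₂ + x * (a₃ + x * (a₄ + x * (a₅ + x * 0#)))))
      ∼ a₅ * (x * (x * (x * (x * x)))) + a₄ * (x * (x * (x * x))) + a₃ * (x * (x * x)) + a₂ * (x * x) + a₁ * x + a₀
  horner-expand = solve 7 (λ a₅ a₄ a₃ a₂ a₁ a₀ x →
    a₀ :+ x :* (a₁ :+ x :* (a₂ :+ x :* (a₃ :+ x :* (a₄ :+ x :* (a₅ :+ x :* con 0)))))
      := a₅ :* (x :* (x :* (x :* (x :* x)))) :+ a₄ :* (x :* (x :* (x :* x))) :+ a₃ :* (x :* (x :* x)) :+ a₂ :* (x :* x) :+ a₁ :* x :+ a₀) ∼-refl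

  divide-constant : ∀ c a y → c + (a + y) * 0# ∼ c + a * 0# + y * 0#
  divide-constant = solve 3 (λ c a y → c :+ (a :+ y) :* con 0 := c :+ a :* con 0 :+ y :* con 0) ∼-refl

  -- One step of synthetic division by `x - a`, with `x` written as `a + y`: `e` is the value at `a`
  -- of the polynomial without its constant term `c`, and `q` the value of its quotient at `x`.
  divide-step : ∀ c a y e q → c + (a + y) * (e + y * q) ∼ (c + a * e) + y * (e + (a + y) * q)
  divide-step = solve 5 (λ c a y e q →
    c :+ (a :+ y) :* (e :+ y :* q) := (c :+ a :* e) :+ y :* (e :+ (a :+ y) :* q)) ∼-refl

  add-step : ∀ a b x e f → a + b + x * (e + f) ∼ (a + x * e) + (b + x * f)
  add-step = solve 5 (λ a b x e f → a :+ b :+ x :* (e :+ f) := (a :+ x :* e) :+ (b :+ x :* f)) ∼-refl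

ι-horner : ∀ a₅ a₄ a₃ a₂ a₁ a₀ x →
  ι (((((a₅ ℤ.* x ℤ.+ a₄) ℤ.* x ℤ.+ a₃) ℤ.* x ℤ.+ a₂) ℤ.* x ℤ.+ a₁) ℤ.* x ℤ.+ a₀)
    ≡ ((((ι a₅ ℚ.* ι x ℚ.+ ι a₄) ℚ.* ι x ℚ.+ ι a₃) ℚ.* ι x ℚ.+ ι a₂) ℚ.* ι x ℚ.+ ι a₁) ℚ.* ι x ℚ.+ ι a₀
ι-horner a₅ a₄ a₃ a₂ a₁ a₀ x = step q₁ a₀ (step q₂ a₁ (step q₃ a₂ (step q₄ a₃ (step a₅ a₄ refl))))
  where
  q₄ = a₅ ℤ.* x ℤ.+ a₄
  q₃ = q₄ ℤ.* x ℤ.+ a₃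
  q₂ = q₃ ℤ.* x ℤ.+ a₂
  q₁ = q₂ ℤ.* x ℤ.+ a₁
  step : ∀ p {p′} b → ι p ≡ p′ → ι (p ℤ.* x ℤ.+ b) ≡ p′ ℚ.* ι x ℚ.+ ι b
  step p b refl = trans (ι-+ (p ℤ.* x) b) (cong (ℚ._+ ι b) (ι-* p x))

ι-neg-* : ∀ a r → ι (ℤ.- a) ℚ.* r ≡ ℚ.- (ι a ℚ.* r)
ι-neg-* a r = trans (cong (ℚ._* r) (ι-neg a)) (sym (ℚ.neg-distribˡ-* (ι a) r))

eval-quintic : ∀ a₂ a₁ a₀ x →
  eval (quinticPolynomial (ι a₂ ℚ.* 1/120) (ι a₁ ℚ.* 1/120) (ι a₀ ℚ.* 1/120)) (ι x) ≡ ι (quintic a₂ a₁ a₀ x) ℚ.* 1/120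
eval-quintic a₂ a₁ a₀ x = begin
  eval (quinticPolynomial (ι a₂ ℚ.* 1/120) (ι a₁ ℚ.* 1/120) (ι a₀ ℚ.* 1/120)) (ι x)
    ≡⟨ cong₂ (λ b₂ b₀ → eval (b₀ ∷ ι a₁ ℚ.* 1/120 ∷ b₂ ∷ ι (+ 8080) ℚ.* 1/120 ∷ ι (ℤ.- (+ 765)) ℚ.* 1/120 ∷ ι (+ 36) ℚ.* 1/120 ∷ []) (ι x))
         (ι-neg-* a₂ 1/120) (ι-neg-* a₀ 1/120) ⟨
  eval (List.map (λ a → ι a ℚ.* 1/120) (ℤ.- a₀ ∷ a₁ ∷ ℤ.- a₂ ∷ + 8080 ∷ ℤ.- (+ 765) ∷ + 36 ∷ [])) (ι x)
    ≡⟨ horner-scale ℚ-commutativeSemiring (ι (+ 36)) (ι (ℤ.- (+ 765))) (ι (+ 8080)) (ι (ℤ.- a₂)) (ι a₁) (ι (ℤ.- a₀)) 1/120 (ι x) ⟩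
  (((((ι (+ 36) ℚ.* ι x ℚ.+ ι (ℤ.- (+ 765))) ℚ.* ι x ℚ.+ ι (+ 8080)) ℚ.* ι x ℚ.+ ι (ℤ.- a₂)) ℚ.* ι x ℚ.+ ι a₁) ℚ.* ι x ℚ.+ ι (ℤ.- a₀)) ℚ.* 1/120
    ≡⟨ cong (ℚ._* 1/120) (ι-horner (+ 36) (ℤ.- (+ 765)) (+ 8080) (ℤ.- a₂) a₁ (ℤ.- a₀) x) ⟨
  ι (quintic a₂ a₁ a₀ x) ℚ.* 1/120 ∎
  where open ≡-Reasoning

fromℕ-^-suc : ∀ t k {y} → fromℕ (t ℕ.^ k) ≡ y → fromℕ (t ℕ.^ suc k) ≡ fromℕ t ℚ.* y
fromℕ-^-suc t k refl = fromℕ-* t (t ℕ.^ k)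

eval-expanded : ∀ a₂ a₁ a₀ t → eval (quinticPolynomial a₂ a₁ a₀) (fromℕ t) ≡
  + 3 ℚ./ 10 ℚ.* fromℕ (t ℕ.^ 5) ℚ.- + 51 ℚ./ 8 ℚ.* fromℕ (t ℕ.^ 4) ℚ.+ + 202 ℚ./ 3 ℚ.* fromℕ (t ℕ.^ 3)
    ℚ.- a₂ ℚ.* fromℕ (t ℕ.^ 2) ℚ.+ a₁ ℚ.* fromℕ t ℚ.- a₀
eval-expanded a₂ a₁ a₀ t = begin
  eval (quinticPolynomial a₂ a₁ a₀) x
    ≡⟨ horner-expand ℚ-commutativeSemiring (+ 3 ℚ./ 10) (ℚ.- (+ 51 ℚ./ 8)) (+ 202 ℚ./ 3) (ℚ.- a₂) a₁ (ℚ.- a₀) x ⟩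
  monomials (+ 3 ℚ./ 10 ℚ.* x⁵) (ℚ.- (+ 51 ℚ./ 8) ℚ.* x⁴) (+ 202 ℚ./ 3 ℚ.* x³) (ℚ.- a₂ ℚ.* x²)
    ≡⟨ cong₂ (λ m₄ m₂ → monomials (+ 3 ℚ./ 10 ℚ.* x⁵) m₄ (+ 202 ℚ./ 3 ℚ.* x³) m₂)
         (ℚ.neg-distribˡ-* (+ 51 ℚ./ 8) x⁴) (ℚ.neg-distribˡ-* a₂ x²) ⟨
  monomials (+ 3 ℚ./ 10 ℚ.* x⁵) (ℚ.- (+ 51 ℚ./ 8 ℚ.* x⁴)) (+ 202 ℚ./ 3 ℚ.* x³) (ℚ.- (a₂ ℚ.* x²))
    ≡⟨ cong₂ (λ m₅ m₄ → monomials (+ 3 ℚ./ 10 ℚ.* m₅) (ℚ.- (+ 51 ℚ./ 8 ℚ.* m₄)) (+ 202 ℚ./ 3 ℚ.* x³) (ℚ.- (a₂ ℚ.* x²))) t⁵ t⁴ ⟨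
  monomials (+ 3 ℚ./ 10 ℚ.* fromℕ (t ℕ.^ 5)) (ℚ.- (+ 51 ℚ./ 8 ℚ.* fromℕ (t ℕ.^ 4))) (+ 202 ℚ./ 3 ℚ.* x³) (ℚ.- (a₂ ℚ.* x²))
    ≡⟨ cong₂ (λ m₃ m₂ → monomials (+ 3 ℚ./ 10 ℚ.* fromℕ (t ℕ.^ 5)) (ℚ.- (+ 51 ℚ./ 8 ℚ.* fromℕ (t ℕ.^ 4)))
         (+ 202 ℚ./ 3 ℚ.* m₃) (ℚ.- (a₂ ℚ.* m₂))) t³ t² ⟨
  monomials (+ 3 ℚ./ 10 ℚ.* fromℕ (t ℕ.^ 5)) (ℚ.- (+ 51 ℚ./ 8 ℚ.* fromℕ (t ℕ.^ 4)))
    (+ 202 ℚ./ 3 ℚ.* fromℕ (t ℕ.^ 3)) (ℚ.- (a₂ ℚ.* fromℕ (t ℕ.^ 2))) ∎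
  where
  open ≡-Reasoning
  x = fromℕ t
  x² = x ℚ.* x
  x³ = x ℚ.* x²
  x⁴ = x ℚ.* x³
  x⁵ = x ℚ.* x⁴
  monomials : ℚ → ℚ → ℚ → ℚ → ℚ
  monomials m₅ m₄ m₃ m₂ = m₅ ℚ.+ m₄ ℚ.+ m₃ ℚ.+ m₂ ℚ.+ a₁ ℚ.* x ℚ.- a₀
  t² = fromℕ-^-suc t 1 (cong fromℕ (ℕ.*-identityʳ t))
  t³ = fromℕ-^-suc t 2 t²
  t⁴ = fromℕ-^-suc t 3 t³
  t⁵ = fromℕ-^-suc t 4 t⁴

quasipolynomialAt : ℕ → Polynomial
quasipolynomialAt t = quinticPolynomial (c₂ t) (c₁ t) (c₀ t)

quasipolynomialAt-120 : ∀ t → quasipolynomialAt t ≡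
  quinticPolynomial (ι (120c₂ t) ℚ.* 1/120) (ι (120c₁ t) ℚ.* 1/120) (ι (120c₀ t) ℚ.* 1/120)
quasipolynomialAt-120 t = trans
  (cong₂ (λ a₂ a₁ → quinticPolynomial a₂ a₁ (c₀ t)) (c₂-120 t) (c₁-120 t))
  (cong (quinticPolynomial (ι (120c₂ t) ℚ.* 1/120) (ι (120c₁ t) ℚ.* 1/120)) (c₀-120 t))

fromℕ-divide : ∀ {m r} → fromℕ m ℚ.* r ≡ 1ℚ → ∀ {a} n → a ≡ + (m ℕ.* n) → fromℕ n ≡ ι a ℚ.* r
fromℕ-divide {m} {r} mr≡1 n refl = begin
  fromℕ n                             ≡⟨ ℚ.*-identityʳ (fromℕ n) ⟨
  fromℕ n ℚ.* 1ℚ                      ≡⟨ cong (fromℕ n ℚ.*_) mr≡1 ⟨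
  fromℕ n ℚ.* (fromℕ m ℚ.* r)         ≡⟨ ℚ.*-assoc (fromℕ n) (fromℕ m) r ⟨
  fromℕ n ℚ.* fromℕ m ℚ.* r           ≡⟨ cong (ℚ._* r) (fromℕ-* n m) ⟨
  fromℕ (n ℕ.* m) ℚ.* r               ≡⟨ cong (λ k → fromℕ k ℚ.* r) (ℕ.*-comm n m) ⟩
  fromℕ (m ℕ.* n) ℚ.* r               ∎
  where open ≡-Reasoning

fromℕ-Lᶜ : ∀ t → 1 ≤ t → fromℕ (Lᶜ t) ≡ eval (quasipolynomialAt t) (fromℕ t)
fromℕ-Lᶜ t 1≤t = begin
  fromℕ (Lᶜ t)                                     ≡⟨ fromℕ-divide {120} {1/120} refl (Lᶜ t) (120Lᶜ 1≤t) ⟩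
  ι (quasi t) ℚ.* 1/120                            ≡⟨ eval-quintic (120c₂ t) (120c₁ t) (120c₀ t) (+ t) ⟨
  eval (quinticPolynomial (ι (120c₂ t) ℚ.* 1/120) (ι (120c₁ t) ℚ.* 1/120) (ι (120c₀ t) ℚ.* 1/120)) (fromℕ t)
                                                   ≡⟨ cong (λ f → eval f (fromℕ t)) (quasipolynomialAt-120 t) ⟨
  eval (quasipolynomialAt t) (fromℕ t)             ∎
  where open ≡-Reasoning

periodic⇒multiples : ∀ {A : Set} {f : ℕ → A} {p} → (∀ t → f (p ℕ.+ t) ≡ f t) → ∀ k t → f (k ℕ.* p ℕ.+ t) ≡ f t
periodic⇒multiples         per zero    t = refl
periodic⇒multiples {f = f} {p} per (suc k) t = trans (cong f (ℕ.+-assoc p (k ℕ.* p) t))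
  (trans (per (k ℕ.* p ℕ.+ t)) (periodic⇒multiples {f = f} per k t))

quasipolynomialAt-periodic : ∀ t → quasipolynomialAt (60 ℕ.+ t) ≡ quasipolynomialAt t
quasipolynomialAt-periodic t = begin
  quasipolynomialAt (60 ℕ.+ t)        ≡⟨ quasipolynomialAt-120 (60 ℕ.+ t) ⟩
  constituent (120c₂ (60 ℕ.+ t)) (120c₁ (60 ℕ.+ t)) (120c₀ (60 ℕ.+ t))
    ≡⟨ cong (constituent (120c₂ t) (120c₁ t)) (120c₀-periodic t) ⟩
  constituent (120c₂ t) (120c₁ t) (120c₀ t)       ≡⟨ quasipolynomialAt-120 t ⟨
  quasipolynomialAt t                 ∎
  where
  open ≡-Reasoning
  constituent : ℤ → ℤ → ℤ → Polynomial
  constituent a₂ a₁ a₀ = quinticPolynomial (ι a₂ ℚ.* 1/120) (ι a₁ ℚ.* 1/120) (ι a₀ ℚ.* 1/120)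

quasipolynomialAt-mod : ∀ t → quasipolynomialAt (toℕ (t mod 60)) ≡ quasipolynomialAt t
quasipolynomialAt-mod t = begin
  quasipolynomialAt (toℕ (t mod 60))                 ≡⟨ cong quasipolynomialAt (Fin.toℕ-fromℕ< (m%n<n t 60)) ⟩
  quasipolynomialAt (t % 60)
    ≡⟨ periodic⇒multiples {f = quasipolynomialAt} quasipolynomialAt-periodic (t ℕ./ 60) (t % 60) ⟨
  quasipolynomialAt (t ℕ./ 60 ℕ.* 60 ℕ.+ t % 60)
    ≡⟨ cong quasipolynomialAt (ℕ.+-comm (t ℕ./ 60 ℕ.* 60) (t % 60)) ⟩
  quasipolynomialAt (t % 60 ℕ.+ t ℕ./ 60 ℕ.* 60)       ≡⟨ cong quasipolynomialAt (m≡m%n+[m/n]*n t 60) ⟨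
  quasipolynomialAt t                                ∎
  where open ≡-Reasoning

Lᶜ-quasipolynomial : Quasipolynomial (λ t → fromℕ (Lᶜ t)) 60
Lᶜ-quasipolynomial = record
  { constituent = λ r → quasipolynomialAt (toℕ r)
  ; represents  = λ t 1≤t → trans (fromℕ-Lᶜ t 1≤t)
      (cong (λ f → eval f (fromℕ t)) (sym (quasipolynomialAt-mod t)))
  }

c₂-even : ∀ t → 2 ∣ t → c₂ t ≡ + 3769 ℚ./ 10
c₂-even t 2∣t = cong (lookup c₂-values) (Fin.fromℕ<-cong (t % 2) 0 (n∣m⇒m%n≡0 t 2 2∣t) (m%n<n t 2) (s≤s z≤n))

c₂-odd : ∀ t → 2 ∤ t → c₂ t ≡ + 7493 ℚ./ 20
c₂-odd t 2∤t = cong (lookup c₂-values)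
  (Fin.fromℕ<-cong (t % 2) 1 (odd (m%n<n t 2) (2∤t ∘ m%n≡0⇒n∣m t 2)) (m%n<n t 2) (s≤s (s≤s z≤n)))
  where
  odd : ∀ {r} → r ℕ.< 2 → r ≢ 0 → r ≡ 1
  odd {zero}        _               r≢0 = ⊥-elim (r≢0 refl)
  odd {suc zero}    _               _   = refl
  odd {suc (suc r)} (s≤s (s≤s ()))  _

-- Minimality of the period

open import Data.Rational.Base using (_+_; _-_; _*_; _/_; -_)

-- The quotient of c ∷ f by x - a does not depend on c.
quotient : ℚ → Polynomial → Polynomial
quotient a []      = []
quotient a (c ∷ f) = eval (c ∷ f) a ∷ quotient a f

length-quotient : ∀ a f → length (quotient a f) ≡ length f
length-quotient a []      = refl
length-quotient a (c ∷ f) = cong suc (length-quotient a f)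

eval-quotient : ∀ c f a y → eval (c ∷ f) (a + y) ≡ eval (c ∷ f) a + y * eval (quotient a f) (a + y)
eval-quotient c []      a y = divide-constant ℚ-commutativeSemiring c a y
eval-quotient c (d ∷ f) a y = trans
  (cong (λ e → c + (a + y) * e) (eval-quotient d f a y))
  (divide-step ℚ-commutativeSemiring c a y (eval (d ∷ f) a) (eval (quotient a f) (a + y)))

y≡x+[y-x] : ∀ x y → y ≡ x + (y - x)
y≡x+[y-x] x y = begin
  y              ≡⟨ ℚ.+-identityʳ y ⟨
  y + 0ℚ         ≡⟨ cong (y ℚ.+_) (ℚ.+-inverseˡ x) ⟨
  y + (- x + x)  ≡⟨ ℚ.+-assoc y (- x) x ⟨
  y - x + x      ≡⟨ ℚ.+-comm (y - x) x ⟩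
  x + (y - x)    ∎
  where open ≡-Reasoning

*-zero-factor : ∀ x y → x ≢ 0ℚ → x * y ≡ 0ℚ → y ≡ 0ℚ
*-zero-factor x y x≢0 xy≡0 = begin
  y                ≡⟨ ℚ.*-identityˡ y ⟨
  1ℚ * y           ≡⟨ cong (_* y) (ℚ.*-inverseˡ x) ⟨
  ℚ.1/ x * x * y   ≡⟨ ℚ.*-assoc (ℚ.1/ x) x y ⟩
  ℚ.1/ x * (x * y) ≡⟨ cong (ℚ.1/ x *_) xy≡0 ⟩
  ℚ.1/ x * 0ℚ      ≡⟨ ℚ.*-zeroʳ (ℚ.1/ x) ⟩
  0ℚ               ∎
  where
  open ≡-Reasoning
  instance _ = ℚ.≢-nonZero x≢0

-- Dividing by `x - s 0` shortens the coefficient list by one, and the other `s k`, being different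
-- from `s 0`, are roots of the quotient. Eventually the empty list remains.
manyRoots⇒zero : ∀ f (s : ℕ → ℚ) → Injective _≡_ _≡_ s → (∀ k → eval f (s k) ≡ 0ℚ) → ∀ x → eval f x ≡ 0ℚ
manyRoots⇒zero f = go (length f) f refl
  where
  go : ∀ n f → length f ≡ n → (s : ℕ → ℚ) → Injective _≡_ _≡_ s →
    (∀ k → eval f (s k) ≡ 0ℚ) → ∀ x → eval f x ≡ 0ℚ
  go _       []      _  s s-inj root x = refl
  go (suc n) (c ∷ f) eq s s-inj root x = begin
    eval (c ∷ f) x                                           ≡⟨ divide x ⟩
    (x - a) * eval (quotient a f) x                          ≡⟨ cong ((x - a) *_) (quotient-zero x) ⟩
    (x - a) * 0ℚ                                             ≡⟨ ℚ.*-zeroʳ (x - a) ⟩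
    0ℚ                                                       ∎
    where
    open ≡-Reasoning
    a = s 0
    divide : ∀ x → eval (c ∷ f) x ≡ (x - a) * eval (quotient a f) x
    divide x = begin
      eval (c ∷ f) x
        ≡⟨ cong (eval (c ∷ f)) (y≡x+[y-x] a x) ⟩
      eval (c ∷ f) (a + (x - a))
        ≡⟨ eval-quotient c f a (x - a) ⟩
      eval (c ∷ f) a + (x - a) * eval (quotient a f) (a + (x - a))
        ≡⟨ cong₂ (λ e y → e + (x - a) * eval (quotient a f) y) (root 0) (sym (y≡x+[y-x] a x)) ⟩
      0ℚ + (x - a) * eval (quotient a f) x
        ≡⟨ ℚ.+-identityˡ _ ⟩
      (x - a) * eval (quotient a f) x ∎
    s-distinct : ∀ k → s (suc k) - a ≢ 0ℚ
    s-distinct k eq with () ← s-inj (trans (y≡x+[y-x] a (s (suc k))) (trans (cong (a ℚ.+_) eq) (ℚ.+-identityʳ a)))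
    quotient-zero : ∀ x → eval (quotient a f) x ≡ 0ℚ
    quotient-zero = go n (quotient a f) (trans (length-quotient a f) (ℕ.suc-injective eq)) (s ∘ suc)
      (ℕ.suc-injective ∘ s-inj)
      (λ k → *-zero-factor (s (suc k) - a) _ (s-distinct k) (trans (sym (divide (s (suc k)))) (root (suc k))))

infixl 6 _⊹_
_⊹_ : Polynomial → Polynomial → Polynomial
[]      ⊹ g       = g
(a ∷ f) ⊹ []      = a ∷ f
(a ∷ f) ⊹ (b ∷ g) = a + b ∷ f ⊹ g

eval-+ : ∀ f g x → eval (f ⊹ g) x ≡ eval f x + eval g x
eval-+ []      g       x = sym (ℚ.+-identityˡ _)
eval-+ (a ∷ f) []      x = sym (ℚ.+-identityʳ _)
eval-+ (a ∷ f) (b ∷ g) x = trans (cong (λ e → a + b + x * e) (eval-+ f g x))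
  (add-step ℚ-commutativeSemiring a b x (eval f x) (eval g x))

eval-neg : ∀ f x → eval (List.map -_ f) x ≡ - eval f x
eval-neg []      x = refl
eval-neg (a ∷ f) x = begin
  - a + x * eval (List.map -_ f) x    ≡⟨ cong (λ e → - a + x * e) (eval-neg f x) ⟩
  - a + x * - eval f x                ≡⟨ cong (- a ℚ.+_) (ℚ.neg-distribʳ-* x (eval f x)) ⟨
  - a + - (x * eval f x)              ≡⟨ ℚ.neg-distrib-+ a (x * eval f x) ⟨
  - (a + x * eval f x)                ∎
  where open ≡-Reasoning

agreeOften⇒agree : ∀ f g (s : ℕ → ℚ) → Injective _≡_ _≡_ s → (∀ k → eval f (s k) ≡ eval g (s k)) →
  ∀ x → eval f x ≡ eval g x
agreeOften⇒agree f g s s-inj agree x = begin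
  eval f x                           ≡⟨ y≡x+[y-x] (eval g x) (eval f x) ⟩
  eval g x + (eval f x - eval g x)
    ≡⟨ cong (eval g x ℚ.+_) (trans (sym (difference x))
         (manyRoots⇒zero (f ⊹ List.map -_ g) s s-inj roots x)) ⟩
  eval g x + 0ℚ                      ≡⟨ ℚ.+-identityʳ (eval g x) ⟩
  eval g x                           ∎
  where
  open ≡-Reasoning
  difference : ∀ x → eval (f ⊹ List.map -_ g) x ≡ eval f x - eval g x
  difference x = trans (eval-+ f (List.map -_ g) x) (cong (eval f x ℚ.+_) (eval-neg g x))
  roots : ∀ k → eval (f ⊹ List.map -_ g) (s k) ≡ 0ℚ
  roots k = trans (difference (s k)) (trans (cong (_- eval g (s k)) (agree k)) (ℚ.+-inverseʳ (eval g (s k))))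

mod-cong : ∀ {m n} o .{{_ : NonZero o}} → m % o ≡ n % o → m mod o ≡ n mod o
mod-cong {m} {n} o eq = Fin.fromℕ<-cong (m % o) (n % o) eq (m%n<n m o) (m%n<n n o)

module _ {N : ℕ → ℚ} {p q} .{{_ : NonZero p}} .{{_ : NonZero q}}
         (P : Quasipolynomial N p) (Q : Quasipolynomial N q) where
  open Quasipolynomial

  -- At `t` plus a multiple of `p * q` both quasipolynomials use the same constituents as at `t`,
  -- and both equal `N` there. Polynomials that agree at infinitely many points agree everywhere.
  constituents-agree : ∀ t x → eval (constituent P (t mod p)) x ≡ eval (constituent Q (t mod q)) x
  constituents-agree t = agreeOften⇒agree (constituent P (t mod p)) (constituent Q (t mod q))
    (fromℕ ∘ point) (point-injective ∘ fromℕ-injective) λ k → begin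
    eval (constituent P (t mod p)) (fromℕ (point k))
      ≡⟨ cong (λ r → eval (constituent P r) (fromℕ (point k))) (mod-cong p (sym (point-p k))) ⟩
    eval (constituent P (point k mod p)) (fromℕ (point k))
      ≡⟨ represents P (point k) (point-≥ k) ⟨
    N (point k)
      ≡⟨ represents Q (point k) (point-≥ k) ⟩
    eval (constituent Q (point k mod q)) (fromℕ (point k))
      ≡⟨ cong (λ r → eval (constituent Q r) (fromℕ (point k))) (mod-cong q (point-q k)) ⟩
    eval (constituent Q (t mod q)) (fromℕ (point k)) ∎
    where
    open ≡-Reasoning
    instance _ = ℕ.m*n≢0 p q
    point : ℕ → ℕ
    -- `suc k` keeps the point positive when `t` is 0, where neither quasipolynomial says anything
    -- about `N`.
    point k = t ℕ.+ suc k ℕ.* (p ℕ.* q)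
    point-p : ∀ k → point k % p ≡ t % p
    point-p k = trans (cong (λ m → (t ℕ.+ m) % p) (regroup (suc k) p q)) ([m+kn]%n≡m%n t (suc k ℕ.* q) p)
      where
      regroup : ∀ k p q → k ℕ.* (p ℕ.* q) ≡ k ℕ.* q ℕ.* p
      regroup = solve-∀-ℕ
    point-q : ∀ k → point k % q ≡ t % q
    point-q k = trans (cong (λ m → (t ℕ.+ m) % q) (sym (ℕ.*-assoc (suc k) p q))) ([m+kn]%n≡m%n t (suc k ℕ.* p) q)
    point-≥ : ∀ k → 1 ≤ point k
    point-≥ k = ℕ.m≤n⇒m≤o+n t (ℕ.>-nonZero⁻¹ (suc k ℕ.* (p ℕ.* q)) {{ℕ.m*n≢0 (suc k) (p ℕ.* q)}})
    point-injective : Injective _≡_ _≡_ point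
    point-injective eq = ℕ.suc-injective (ℕ.*-cancelʳ-≡ _ _ (p ℕ.* q) (ℕ.+-cancelˡ-≡ t _ _ eq))

-- The index stands for the candidate period `suc q`, from 1 to 59; evaluation finds for each a
-- counterexample below 60.
120c₀-aperiodic : ∀ (q : Fin 59) → ∃[ t ] 120c₀ (suc (toℕ q) ℕ.+ toℕ {60} t) ≢ 120c₀ (toℕ t)
120c₀-aperiodic = toWitness
  {a? = Fin.all? λ q → Fin.any? λ t → ¬? (120c₀ (suc (toℕ q) ℕ.+ toℕ {60} t) ℤ.≟ 120c₀ (toℕ t))} _

c₀⇒120c₀ : ∀ s t → c₀ s ≡ c₀ t → 120c₀ s ≡ 120c₀ t
c₀⇒120c₀ s t eq = ι-injective (begin
  ι (120c₀ s)                        ≡⟨ undo s ⟩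
  c₀ s * fromℕ 120                   ≡⟨ cong (_* fromℕ 120) eq ⟩
  c₀ t * fromℕ 120                   ≡⟨ undo t ⟨
  ι (120c₀ t)                        ∎)
  where
  open ≡-Reasoning
  undo : ∀ t → ι (120c₀ t) ≡ c₀ t * fromℕ 120
  undo t = begin
    ι (120c₀ t)                          ≡⟨ ℚ.*-identityʳ (ι (120c₀ t)) ⟨
    ι (120c₀ t) * (1/120 * fromℕ 120)    ≡⟨ ℚ.*-assoc (ι (120c₀ t)) 1/120 (fromℕ 120) ⟨
    ι (120c₀ t) * 1/120 * fromℕ 120      ≡⟨ cong (_* fromℕ 120) (c₀-120 t) ⟨
    c₀ t * fromℕ 120                     ∎

eval-0 : ∀ a f → eval (a ∷ f) 0ℚ ≡ a
eval-0 a f = trans (cong (a ℚ.+_) (ℚ.*-zeroˡ (eval f 0ℚ))) (ℚ.+-identityʳ a)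

Lᶜ-minimalModulus : IsMinimalModulus (λ t → fromℕ (Lᶜ t)) 60
Lᶜ-minimalModulus q@(suc q-1) Q = ℕ.≮⇒≥ λ q<60 →
  let i = fromℕ< (ℕ.s<s⁻¹ q<60)
      (t , aperiodic) = 120c₀-aperiodic i
  in aperiodic (subst (λ q-1 → 120c₀ (suc q-1 ℕ.+ toℕ t) ≡ 120c₀ (toℕ t)) (sym (Fin.toℕ-fromℕ< (ℕ.s<s⁻¹ q<60)))
       (c₀⇒120c₀ (q ℕ.+ toℕ t) (toℕ t) (periodic (toℕ t))))
  where
  open ≡-Reasoning
  -- Constituents are determined as functions only, since a coefficient list may end in zeros;
  -- evaluation at 0 isolates the constant term.
  constant : ∀ t → eval (Quasipolynomial.constituent Q (t mod q)) 0ℚ ≡ - c₀ t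
  constant t = begin
    eval (Quasipolynomial.constituent Q (t mod q)) 0ℚ    ≡⟨ constituents-agree Lᶜ-quasipolynomial Q t 0ℚ ⟨
    eval (quasipolynomialAt (toℕ (t mod 60))) 0ℚ         ≡⟨ cong (λ f → eval f 0ℚ) (quasipolynomialAt-mod t) ⟩
    eval (quasipolynomialAt t) 0ℚ                        ≡⟨ eval-0 (- c₀ t) (List.drop 1 (quasipolynomialAt t)) ⟩
    - c₀ t                                               ∎
  periodic : ∀ t → c₀ (q ℕ.+ t) ≡ c₀ t
  periodic t = ℚ.neg-injective (begin
    - c₀ (q ℕ.+ t)                                              ≡⟨ constant (q ℕ.+ t) ⟨
    eval (Quasipolynomial.constituent Q ((q ℕ.+ t) mod q)) 0ℚ
      ≡⟨ cong (λ r → eval (Quasipolynomial.constituent Q r) 0ℚ)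
           (mod-cong {q ℕ.+ t} {t} q (trans (cong (_% q) (ℕ.+-comm q t)) ([m+n]%n≡m%n t q))) ⟩
    eval (Quasipolynomial.constituent Q (t mod q)) 0ℚ           ≡⟨ constant t ⟩
    - c₀ t                                                      ∎)

mainTheorem5 :
    (generatingFunction Lᶜ
       ≈ 12 · X^ 4 ⊛ B
       ÷ (𝟙 ⊖ X^ 2) ^ 2 ⊛ (𝟙 ⊖ X^ 3) ^ 2 ⊛ (𝟙 ⊖ X^ 4) ⊛ (𝟙 ⊖ X^ 5))
    × (∀ (t : ℕ) → 1 ≤ t →
        (2 ∣ t → fromℕ (Lᶜ t) ≡
            + 3 / 10 * fromℕ (t ℕ.^ 5) - + 51 / 8 * fromℕ (t ℕ.^ 4)
              + + 202 / 3 * fromℕ (t ℕ.^ 3) - + 3769 / 10 * fromℕ (t ℕ.^ 2)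
              + c₁ t * fromℕ t - c₀ t)
      × (2 ∤ t → fromℕ (Lᶜ t) ≡
            + 3 / 10 * fromℕ (t ℕ.^ 5) - + 51 / 8 * fromℕ (t ℕ.^ 4)
              + + 202 / 3 * fromℕ (t ℕ.^ 3) - + 7493 / 20 * fromℕ (t ℕ.^ 2)
              + c₁ t * fromℕ t - c₀ t))
    × (Σ (Quasipolynomial (λ t → fromℕ (Lᶜ t)) 60) λ L →
          IsMinimalModulus (λ t → fromℕ (Lᶜ t)) 60
        × principal L ≡
            - (+ 948 / 1) ∷ + 994 / 1 ∷ - (+ 3769 / 10) ∷ + 202 / 3
              ∷ - (+ 51 / 8) ∷ + 3 / 10 ∷ [])
mainTheorem5 =
    generatingFunction-Lᶜ-÷
  , (λ t 1≤t → (λ 2∣t → formula t 1≤t (c₂-even t 2∣t)) , (λ 2∤t → formula t 1≤t (c₂-odd t 2∤t)))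
  , Lᶜ-quasipolynomial , Lᶜ-minimalModulus , refl
  where
  formula : ∀ t → 1 ≤ t → ∀ {a₂} → c₂ t ≡ a₂ → fromℕ (Lᶜ t) ≡
    + 3 / 10 * fromℕ (t ℕ.^ 5) - + 51 / 8 * fromℕ (t ℕ.^ 4) + + 202 / 3 * fromℕ (t ℕ.^ 3)
      - a₂ * fromℕ (t ℕ.^ 2) + c₁ t * fromℕ t - c₀ t
  formula t 1≤t c₂≡a₂ = trans (fromℕ-Lᶜ t 1≤t) (trans (eval-expanded (c₂ t) (c₁ t) (c₀ t) t)
    (cong (λ a → + 3 / 10 * fromℕ (t ℕ.^ 5) - + 51 / 8 * fromℕ (t ℕ.^ 4) + + 202 / 3 * fromℕ (t ℕ.^ 3)
      - a * fromℕ (t ℕ.^ 2) + c₁ t * fromℕ t - c₀ t) c₂≡a₂))
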